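{- There exists a function $C:\mathbb{N}\to(0,\infty)$ such that $E([n]^d,2)\geq C(d)\,n^d$ for every $n,d\in\mathbb{N}$.
   Context: $[n]^d$ denotes the graph with vertex set $\{1,\dots,n\}^d$ in which two vertices are adjacent iff they differ by $1$ in exactly one coordinate and agree in all others. For a finite graph $G$ and $r\in\mathbb{N}$, in $r$-neighbour bootstrap percolation a vertex becomes infected once at least $r$ of its neighbours are infected, and infected vertices stay infected; an initial set $A\subset V(G)$ percolates if eventually all vertices are infected. A minimal percolating set is a percolating set none of whose proper subsets percolates. $E(G,r)$ is the maximum size of a minimal percolating set of $G$ in $r$-neighbour bootstrap percolation. -}

module Defs where

open import Data.Nat using (ℕ; zero; suc; _≤_)
open import Data.Fin using (Fin; toℕ)
open import Data.Vec using (Vec; lookup)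
open import Data.List using (List; length)
open import Data.List.Membership.Propositional using (_∈_; _∉_)
open import Data.List.Relation.Unary.All using (All)
open import Data.List.Relation.Unary.Unique.Propositional using (Unique)
open import Data.Product using (Σ; _×_; ∃)
open import Data.Sum using (_⊎_)
open import Relation.Binary.PropositionalEquality using (_≡_; _≢_)
open import Relation.Nullary using (¬_)

-- Vertices of the grid [n]^d : d-tuples of elements of {0,…,n-1} (a relabelling of {1,…,n}).
Vertex : ℕ → ℕ → Set
Vertex n d = Vec (Fin n) d

GridAdj : (n d : ℕ) → Vertex n d → Vertex n d → Set
GridAdj n d u v =
  Σ (Fin d) λ i →
    (suc (toℕ (lookup u i)) ≡ toℕ (lookup v i) ⊎ suc (toℕ (lookup v i)) ≡ toℕ (lookup u i))
    × (∀ j → j ≢ i → lookup u j ≡ lookup v j)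

-- r-neighbour bootstrap percolation on a graph (V, Adj), initial set A (given as a list).
-- Infected r A v : v is eventually infected.
data Infected {V : Set} (Adj : V → V → Set) (r : ℕ) (A : List V) : V → Set where
  initial : ∀ {v} → v ∈ A → Infected Adj r A v
  spread  : ∀ {v} (ns : List V) → Unique ns → r ≤ length ns →
            All (λ u → Adj u v) ns → All (Infected Adj r A) ns → Infected Adj r A v

Percolates : {V : Set} → (V → V → Set) → ℕ → List V → Set
Percolates {V} Adj r A = ∀ (v : V) → Infected Adj r A v

MinimalPercolating : {V : Set} → (V → V → Set) → ℕ → List V → Set
MinimalPercolating {V} Adj r A =
  Percolates Adj r A ×
  (∀ (B : List V) → (∀ {x} → x ∈ B → x ∈ A) → (Σ V λ x → x ∈ A × x ∉ B) → ¬ Percolates Adj r B)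

{-# OPTIONS --safe #-}
-- It suffices to find a percolating set A with many elements x such that A ∖ {x} lies in a proper closed
-- set: every minimal percolating subset of A contains all of them.
-- For d ≥ 2 such a set is built from a single vertex by repeated doubling. Two translates of a box along
-- an axis j, at distance 4, are joined by two triggers p and q, placed diagonally at opposite corners and
-- sticking out in another axis i. A complete box absorbs its trigger, and the two enlarged boxes are at
-- distance 2 and merge. If an element x of one box is missing, the closed set blocking it stays
-- away from the corner next to the trigger, so nothing reaches the other box, and the result still
-- avoids two opposite corners of the merged box. A doubling doubles the number of such x and the side j,
-- up to constants; doubling all axes in turn keeps the density positive. The box so obtained is
-- attached by a corner to a completely infected box that fills up the grid.
-- For d = 1, no percolating set misses two consecutive vertices.
module Submission where

open import Defs

module Construction where

  open import Data.Nat using (ℕ; zero; suc; _+_; _*_; _^_; _≤_; _<_; z≤n; s≤s; _≤′_; ≤′-refl; ≤′-step; _≤?_; _≟_)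
  open import Data.Nat.Properties
  open import Data.Nat.Tactic.RingSolver using (solve-∀)
  import Data.Integer as ℤ
  import Data.Integer.Properties as ℤ
  import Data.Rational as ℚ
  import Data.Rational.Properties as ℚ
  import Data.Rational.Unnormalised as ℚᵘ
  import Data.Rational.Unnormalised.Properties as ℚᵘ
  open import Data.Fin using (Fin; zero; suc; toℕ; fromℕ<)
  import Data.Fin.Properties as Fin
  open import Data.Vec using (Vec; []; _∷_; lookup; _[_]≔_; updateAt; zipWith; replicate; map; tabulate; head)
  open import Data.Vec.Properties using (lookup∘update; lookup∘update′; lookup∘updateAt; lookup∘updateAt′; lookup-zipWith; lookup-map; lookup∘tabulate; lookup-replicate; ≡-dec; ∷-injective)
  import Data.List as List
  open import Data.List using (List; []; _∷_; _++_; [_]; length; filter; allFin; cartesianProductWith)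
  open import Data.List.Properties using (length-++; length-map; length-tabulate; filter-notAll)
  open import Data.List.Membership.Propositional using (_∈_; _∉_; find; lose)
  open import Data.List.Membership.Propositional.Properties using (∈-∃++; ∈-map⁺; ∈-map⁻; ∈-++⁺ˡ; ∈-++⁺ʳ; ∈-++⁻; ∈-filter⁺; ∈-filter⁻; ∈-cartesianProductWith⁺; ∈-allFin)
  import Data.List.Membership.DecPropositional as DecMembership
  open import Data.List.Relation.Unary.Any using (here; there; any?)
  import Data.List.Relation.Unary.All as All
  open import Data.List.Relation.Unary.All using ([]; _∷_; all?)
  open import Data.List.Relation.Unary.All.Properties using (All¬⇒¬Any)
  open import Data.List.Relation.Unary.AllPairs using ([]; _∷_)
  open import Data.List.Relation.Unary.Unique.Propositional using (Unique)
  import Data.List.Relation.Unary.Unique.Propositional.Properties as Unique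
  import Data.List.Relation.Unary.Unique.Setoid.Properties as UniqueSetoid
  open import Data.Product using (Σ; _×_; _,_; proj₁; proj₂; ∃)
  open import Data.Sum using (_⊎_; inj₁; inj₂; [_,_]′)
  open import Data.Empty using (⊥; ⊥-elim)
  open import Function using (_∘_; id)
  open import Relation.Nullary using (¬_; Dec; yes; no; ¬?)
  open import Relation.Nullary.Decidable using (_×-dec_; _⊎-dec_; _→-dec_; map′)
  open import Relation.Unary using (_⊆_; _∪_)
  open import Relation.Binary.Definitions using (Decidable; DecidableEquality)
  open import Relation.Binary.PropositionalEquality using (_≡_; _≢_; refl; sym; trans; cong; cong₂; subst; subst₂; setoid; module ≡-Reasoning)

  -- Infection of boxes

  Closed : {V : Set} → (V → V → Set) → (V → Set) → Set
  Closed Adj S = ∀ {u w v} → u ≢ w → Adj u v → Adj w v → S u → S w → S v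

  Pt : ℕ → Set
  Pt = Vec ℕ

  infixl 20 _!_
  _!_ : ∀ {d} → Pt d → Fin d → ℕ
  _!_ = lookup

  Step : ℕ → ℕ → Set
  Step a b = suc a ≡ b ⊎ suc b ≡ a

  record Adj {d} (u v : Pt d) : Set where
    constructor adj
    field
      axis : Fin d
      step : Step (u ! axis) (v ! axis)
      rest : ∀ j → j ≢ axis → u ! j ≡ v ! j

  record Box {d} (l h v : Pt d) : Set where
    constructor mkBox
    field at : ∀ k → l ! k ≤ v ! k × v ! k ≤ h ! k
  open Box

  private variable
    d n c : ℕ
    l h l′ h′ u v w z : Pt d
    S X Y Z : Pt d → Set

  lookup-ext : {u v : Pt d} → (∀ k → u ! k ≡ v ! k) → u ≡ v
  lookup-ext {u = []} {[]} _ = refl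
  lookup-ext {u = _ ∷ _} {_ ∷ _} eq = cong₂ _∷_ (eq zero) (lookup-ext (eq ∘ suc))

  Step-sym : ∀ {a b} → Step a b → Step b a
  Step-sym (inj₁ e) = inj₂ e
  Step-sym (inj₂ e) = inj₁ e

  Step⇒≢ : ∀ {a b} → Step a b → a ≢ b
  Step⇒≢ (inj₁ e) refl = 1+n≢n e
  Step⇒≢ (inj₂ e) refl = 1+n≢n e

  Adj-sym : Adj u v → Adj v u
  Adj-sym (adj i s eq) = adj i (Step-sym s) λ j j≢i → sym (eq j j≢i)

  interval-connected : ∀ {a b} (P : ℕ → Set) →
    (∀ {x y} → a ≤ x → x ≤ b → a ≤ y → y ≤ b → Step x y → P x → P y) →
    ∀ {x y} → a ≤ x → x ≤ b → a ≤ y → y ≤ b → P x → P y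
  interval-connected {a} {b} P step {x} {y} a≤x x≤b a≤y y≤b = go (≤-total x y)
    where
    up : ∀ {x y} → a ≤ x → y ≤ b → x ≤′ y → P x → P y
    up a≤x y≤b ≤′-refl p = p
    up a≤x 1+y≤b (≤′-step x≤′y) p =
      step a≤m (<⇒≤ 1+y≤b) (m≤n⇒m≤1+n a≤m) 1+y≤b (inj₁ refl) (up a≤x (<⇒≤ 1+y≤b) x≤′y p)
      where a≤m = ≤-trans a≤x (≤′⇒≤ x≤′y)
    down : ∀ {x y} → x ≤ b → a ≤ y → y ≤′ x → P x → P y
    down x≤b a≤y ≤′-refl p = p
    down 1+x≤b a≤y (≤′-step y≤′x) p =
      down (<⇒≤ 1+x≤b) a≤y y≤′x (step (m≤n⇒m≤1+n a≤m) 1+x≤b a≤m (<⇒≤ 1+x≤b) (inj₂ refl) p)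
      where a≤m = ≤-trans a≤y (≤′⇒≤ y≤′x)
    go : x ≤ y ⊎ y ≤ x → P x → P y
    go (inj₁ x≤y) = up a≤x y≤b (≤⇒≤′ x≤y)
    go (inj₂ y≤x) = down x≤b a≤y (≤⇒≤′ y≤x)

  box-connected : (P : Pt d → Set) →
    (∀ {u v} → Box l h u → Box l h v → Adj u v → P u → P v) →
    Box l h z → Box l h w → P z → P w
  box-connected {l = []} {h = []} {z = []} {w = []} P step bz bw p = p
  box-connected {l = a ∷ l} {h = b ∷ h} {z = x ∷ z} {w = y ∷ w} P step bz bw p =
    box-connected (P ∘ (y ∷_))
      (λ bu bv (adj i s eq) → step (cons by bu) (cons by bv)
        (adj (suc i) s λ { zero _ → refl ; (suc k) ne → eq k (ne ∘ cong suc) }))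
      (mkBox (at bz ∘ suc)) (mkBox (at bw ∘ suc))
      (interval-connected (λ t → P (t ∷ z))
        (λ a≤s s≤b a≤t t≤b st → step (cons (a≤s , s≤b) (mkBox (at bz ∘ suc))) (cons (a≤t , t≤b) (mkBox (at bz ∘ suc)))
          (adj zero st λ { zero ne → ⊥-elim (ne refl) ; (suc k) _ → refl }))
        (proj₁ (at bz zero)) (proj₂ (at bz zero)) (proj₁ by) (proj₂ by) p)
    where
    by = at bw zero
    cons : ∀ {t z} → a ≤ t × t ≤ b → Box l h z → Box (a ∷ l) (b ∷ h) (t ∷ z)
    cons bt bz .at zero = bt
    cons bt bz .at (suc k) = at bz k

  -- Every point of the layer has one neighbour in the box; a second one appears as the infection
  -- walks through the layer, which is connected.
  layer-infected : ∀ i {s t} → Closed Adj S → Box l h ⊆ S → Step s t → l ! i ≤ s → s ≤ h ! i →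
    z ! i ≡ t → (∀ k → k ≢ i → l ! k ≤ z ! k × z ! k ≤ h ! k) → S z →
    w ! i ≡ t → (∀ k → k ≢ i → l ! k ≤ w ! k × w ! k ≤ h ! k) → S w
  layer-infected {S = S} {l = l} {h = h} i {s} {t} cl box st l≤s s≤h zi zk Sz wi wk =
    box-connected {l = l [ i ]≔ t} {h = h [ i ]≔ t} S step (inLayer zi zk) (inLayer wi wk) Sz
    where
    inLayer : ∀ {x} → x ! i ≡ t → (∀ k → k ≢ i → l ! k ≤ x ! k × x ! k ≤ h ! k) →
      Box (l [ i ]≔ t) (h [ i ]≔ t) x
    inLayer {x} xi xk .at k with k Fin.≟ i
    ... | yes refl rewrite lookup∘update i l t | lookup∘update i h t = ≤-reflexive (sym xi) , ≤-reflexive xi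
    ... | no k≢i rewrite lookup∘update′ k≢i l t | lookup∘update′ k≢i h t = xk k k≢i
    layer-i : ∀ {x} → Box (l [ i ]≔ t) (h [ i ]≔ t) x → x ! i ≡ t
    layer-i {x} b with at b i
    ... | p , q rewrite lookup∘update i l t | lookup∘update i h t = ≤-antisym q p
    step : ∀ {x y} → Box (l [ i ]≔ t) (h [ i ]≔ t) x → Box (l [ i ]≔ t) (h [ i ]≔ t) y → Adj x y → S x → S y
    step {x} {y} bx by xy Sx = cl x≢y′ xy y′y Sx (box y′∈)
      where
      y′ = y [ i ]≔ s
      y′i : y′ ! i ≡ s
      y′i = lookup∘update i y s
      x≢y′ : x ≢ y′
      x≢y′ refl = Step⇒≢ st (trans (sym y′i) (layer-i bx))
      y′y : Adj y′ y
      y′y = adj i (subst₂ Step (sym y′i) (sym (layer-i by)) st) λ k k≢i → lookup∘update′ k≢i y s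
      y′∈ : Box l h y′
      y′∈ .at k with k Fin.≟ i
      ... | yes refl rewrite y′i = l≤s , s≤h
      ... | no k≢i with at by k
      ...   | p rewrite lookup∘update′ k≢i y s | lookup∘update′ k≢i l t | lookup∘update′ k≢i h t = p

  Box⇒≤ : Box l h v → ∀ k → l ! k ≤ h ! k
  Box⇒≤ b k = ≤-trans (proj₁ (at b k)) (proj₂ (at b k))

  lower∈Box : (∀ k → l ! k ≤ h ! k) → Box l h l
  lower∈Box l≤h .at k = ≤-refl , l≤h k

  upper∈Box : (∀ k → l ! k ≤ h ! k) → Box l h h
  upper∈Box l≤h .at k = l≤h k , ≤-refl

  record Cover (S : Pt d → Set) (l h v : Pt d) : Set where
    constructor cover
    field
      {lower upper} : Pt d
      inside  : Box lower upper ⊆ S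
      extends : Box l h ⊆ Box lower upper
      covers  : Box lower upper v

  grow : Closed Adj S → Box l h ⊆ S → Box l h u → Adj u v → S v → Cover S l h v
  grow {S = S} {l = l} {h = h} {u = u} {v = v} cl box bu (adj i (inj₁ e) eq) Sv with v ! i ≤? h ! i
  ... | yes vi≤ = cover box (λ b → b) bv
    where
    bv : Box l h v
    bv .at k with k Fin.≟ i
    ... | yes refl = ≤-trans (proj₁ (at bu i)) (≤-trans (n≤1+n _) (≤-reflexive e)) , vi≤
    ... | no k≢i rewrite sym (eq k k≢i) = at bu k
  ... | no vi≰ = cover {upper = h [ i ]≔ v ! i} inside extends covers
    where
    vk : ∀ k → k ≢ i → l ! k ≤ v ! k × v ! k ≤ h ! k
    vk k k≢i rewrite sym (eq k k≢i) = at bu k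
    li≤vi : l ! i ≤ v ! i
    li≤vi = ≤-trans (proj₁ (at bu i)) (≤-trans (n≤1+n _) (≤-reflexive e))
    ui≡hi : u ! i ≡ h ! i
    ui≡hi = ≤-antisym (proj₂ (at bu i)) (≤-pred (≤-trans (≰⇒> vi≰) (≤-reflexive (sym e))))
    inside : Box l (h [ i ]≔ v ! i) ⊆ S
    inside {x} bx with x ! i ≤? h ! i
    ... | yes xi≤ = box (mkBox lem)
      where
      lem : ∀ k → l ! k ≤ x ! k × x ! k ≤ h ! k
      lem k with k Fin.≟ i
      ... | yes refl = proj₁ (at bx i) , xi≤
      ... | no k≢i = subst (λ t → l ! k ≤ x ! k × x ! k ≤ t) (lookup∘update′ k≢i h _) (at bx k)
    ... | no xi≰ = layer-infected {h = h} i cl box (inj₁ e) (proj₁ (at bu i)) (proj₂ (at bu i)) refl vk Sv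
          (≤-antisym (subst (x ! i ≤_) (lookup∘update i h _) (proj₂ (at bx i)))
                     (≤-trans (≤-reflexive (trans (sym e) (cong suc ui≡hi))) (≰⇒> xi≰)))
          λ k k≢i → subst (λ t → l ! k ≤ x ! k × x ! k ≤ t) (lookup∘update′ k≢i h _) (at bx k)
    extends : Box l h ⊆ Box l (h [ i ]≔ v ! i)
    extends bx .at k with k Fin.≟ i
    ... | yes refl rewrite lookup∘update i h (v ! i) = proj₁ (at bx i) , ≤-trans (proj₂ (at bx i)) (<⇒≤ (≰⇒> vi≰))
    ... | no k≢i rewrite lookup∘update′ k≢i h (v ! i) = at bx k
    covers : Box l (h [ i ]≔ v ! i) v
    covers .at k with k Fin.≟ i
    ... | yes refl rewrite lookup∘update i h (v ! i) = li≤vi , ≤-refl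
    ... | no k≢i rewrite lookup∘update′ k≢i h (v ! i) = vk k k≢i
  grow {S = S} {l = l} {h = h} {u = u} {v = v} cl box bu (adj i (inj₂ e) eq) Sv with l ! i ≤? v ! i
  ... | yes ≤vi = cover box (λ b → b) bv
    where
    bv : Box l h v
    bv .at k with k Fin.≟ i
    ... | yes refl = ≤vi , ≤-trans (≤-trans (n≤1+n _) (≤-reflexive e)) (proj₂ (at bu i))
    ... | no k≢i rewrite sym (eq k k≢i) = at bu k
  ... | no ≰vi = cover {lower = l [ i ]≔ v ! i} inside extends covers
    where
    vk : ∀ k → k ≢ i → l ! k ≤ v ! k × v ! k ≤ h ! k
    vk k k≢i rewrite sym (eq k k≢i) = at bu k
    vi≤hi : v ! i ≤ h ! i
    vi≤hi = ≤-trans (≤-trans (n≤1+n _) (≤-reflexive e)) (proj₂ (at bu i))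
    ui≡li : u ! i ≡ l ! i
    ui≡li = ≤-antisym (≤-trans (≤-reflexive (sym e)) (≰⇒> ≰vi)) (proj₁ (at bu i))
    inside : Box (l [ i ]≔ v ! i) h ⊆ S
    inside {x} bx with l ! i ≤? x ! i
    ... | yes ≤xi = box (mkBox lem)
      where
      lem : ∀ k → l ! k ≤ x ! k × x ! k ≤ h ! k
      lem k with k Fin.≟ i
      ... | yes refl = ≤xi , proj₂ (at bx i)
      ... | no k≢i = subst (λ t → t ≤ x ! k × x ! k ≤ h ! k) (lookup∘update′ k≢i l _) (at bx k)
    ... | no ≰xi = layer-infected {h = h} i cl box (inj₂ e) (proj₁ (at bu i)) (proj₂ (at bu i)) refl vk Sv
          (≤-antisym (≤-pred (≤-trans (≰⇒> ≰xi) (≤-reflexive (trans (sym ui≡li) (sym e)))))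
                     (subst (_≤ x ! i) (lookup∘update i l _) (proj₁ (at bx i))))
          λ k k≢i → subst (λ t → t ≤ x ! k × x ! k ≤ h ! k) (lookup∘update′ k≢i l _) (at bx k)
    extends : Box l h ⊆ Box (l [ i ]≔ v ! i) h
    extends bx .at k with k Fin.≟ i
    ... | yes refl rewrite lookup∘update i l (v ! i) = ≤-trans (<⇒≤ (≰⇒> ≰vi)) (proj₁ (at bx i)) , proj₂ (at bx i)
    ... | no k≢i rewrite lookup∘update′ k≢i l (v ! i) = at bx k
    covers : Box (l [ i ]≔ v ! i) h v
    covers .at k with k Fin.≟ i
    ... | yes refl rewrite lookup∘update i l (v ! i) = ≤-refl , vi≤hi
    ... | no k≢i rewrite lookup∘update′ k≢i l (v ! i) = vk k k≢i

  reach : Closed Adj S → Box l h ⊆ S → Box l′ h′ ⊆ S →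
    Box l h z → Box l′ h′ z → Box l′ h′ w → Cover S l h w
  reach {S = S} {l = l} {h = h} cl box box′ bz bz′ bw′ =
    box-connected (Cover S l h) step bz′ bw′ (cover box (λ b → b) bz)
    where
    step : ∀ {u v} → Box _ _ u → Box _ _ v → Adj u v → Cover S l h u → Cover S l h v
    step _ bv uv (cover ins ext cov) with grow cl ins cov uv (box′ bv)
    ... | cover ins′ ext′ cov′ = cover ins′ (λ b → ext′ (ext b)) cov′

  record Hull (S : Pt d → Set) (l h l′ h′ : Pt d) : Set where
    constructor hull
    field
      {lower upper} : Pt d
      inside   : Box lower upper ⊆ S
      extends  : Box l h ⊆ Box lower upper
      extends′ : Box l′ h′ ⊆ Box lower upper

  join : Closed Adj S → Box l h ⊆ S → Box l′ h′ ⊆ S → Box l h u → Box l′ h′ w → u ≢ w →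
    Adj u v → Adj w v → Hull S l h l′ h′
  join cl box box′ bu bw u≢w uv wv
    with grow cl box bu uv (cl u≢w uv wv (box bu) (box′ bw))
  ... | cover ins₁ ext₁ v∈ with grow cl ins₁ v∈ (Adj-sym wv) (box′ bw)
  ... | cover ins₂ ext₂ w∈ with reach cl ins₂ box′ w∈ bw (lower∈Box (Box⇒≤ bw))
  ... | cover ins₃ ext₃ l′∈ with reach cl ins₃ box′ (ext₃ w∈) bw (upper∈Box (Box⇒≤ bw))
  ... | cover ins₄ ext₄ h′∈ = hull ins₄ (λ b → ext₄ (ext₃ (ext₂ (ext₁ b))))
    λ b → mkBox λ k → ≤-trans (proj₁ (at (ext₄ l′∈) k)) (proj₁ (at b k)) , ≤-trans (proj₂ (at b k)) (proj₂ (at h′∈ k))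

  closed-box : Closed Adj (Box l h)
  closed-box {u = u} {w} {v} u≢w (adj i s eq) (adj i′ s′ eq′) bu bw .at k with k Fin.≟ i | k Fin.≟ i′
  ... | no k≢i | _ rewrite sym (eq k k≢i) = at bu k
  ... | _ | no k≢i′ rewrite sym (eq′ k k≢i′) = at bw k
  closed-box {u = u} {w} {v} u≢w (adj i (inj₁ e) eq) (adj i (inj₁ e′) eq′) bu bw .at k | yes refl | yes refl =
    ⊥-elim (u≢w (lookup-ext λ k′ → same k′))
    where
    same : ∀ k′ → u ! k′ ≡ w ! k′
    same k′ with k′ Fin.≟ i
    ... | yes refl = suc-injective (trans e (sym e′))
    ... | no ne = trans (eq k′ ne) (sym (eq′ k′ ne))
  closed-box {u = u} {w} {v} u≢w (adj i (inj₂ e) eq) (adj i (inj₂ e′) eq′) bu bw .at k | yes refl | yes refl =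
    ⊥-elim (u≢w (lookup-ext λ k′ → same k′))
    where
    same : ∀ k′ → u ! k′ ≡ w ! k′
    same k′ with k′ Fin.≟ i
    ... | yes refl = trans (sym e) e′
    ... | no ne = trans (eq k′ ne) (sym (eq′ k′ ne))
  closed-box {u = u} {w} {v} u≢w (adj i (inj₁ e) eq) (adj i (inj₂ e′) eq′) bu bw .at k | yes refl | yes refl =
    ≤-trans (proj₁ (at bu i)) (≤-trans (n≤1+n _) (≤-reflexive e)) ,
    ≤-trans (≤-trans (n≤1+n _) (≤-reflexive e′)) (proj₂ (at bw i))
  closed-box {u = u} {w} {v} u≢w (adj i (inj₂ e) eq) (adj i (inj₁ e′) eq′) bu bw .at k | yes refl | yes refl =
    ≤-trans (proj₁ (at bw i)) (≤-trans (n≤1+n _) (≤-reflexive e′)) ,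
    ≤-trans (≤-trans (n≤1+n _) (≤-reflexive e)) (proj₂ (at bu i))

  -- Closed sets and critical boxes

  Far : (Pt d → Set) → (Pt d → Set) → Set
  Far K L = ∀ {u w v} → K u → L w → Adj u v → Adj w v → ⊥

  closed-∪ : Closed Adj X → Closed Adj Y → Far X Y → Closed Adj (X ∪ Y)
  closed-∪ clK clL far u≢w uv wv (inj₁ Ku) (inj₁ Kw) = inj₁ (clK u≢w uv wv Ku Kw)
  closed-∪ clK clL far u≢w uv wv (inj₂ Lu) (inj₂ Lw) = inj₂ (clL u≢w uv wv Lu Lw)
  closed-∪ clK clL far u≢w uv wv (inj₁ Ku) (inj₂ Lw) = ⊥-elim (far Ku Lw uv wv)
  closed-∪ clK clL far u≢w uv wv (inj₂ Lu) (inj₁ Kw) = ⊥-elim (far Kw Lu wv uv)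

  Far-∪ : Far X Y → Far X Z → Far X (Y ∪ Z)
  Far-∪ KL KM Ku (inj₁ Lw) = KL Ku Lw
  Far-∪ KL KM Ku (inj₂ Mw) = KM Ku Mw

  adj-≤ : Adj u v → ∀ k → u ! k ≤ suc (v ! k)
  adj-≤ (adj i s eq) k with k Fin.≟ i
  adj-≤ (adj i (inj₁ e) eq) k | yes refl = ≤-trans (n≤1+n _) (≤-trans (≤-reflexive e) (n≤1+n _))
  adj-≤ (adj i (inj₂ e) eq) k | yes refl = ≤-reflexive (sym e)
  ... | no k≢i = ≤-trans (≤-reflexive (eq k k≢i)) (n≤1+n _)

  near⇒≤2 : Adj u v → Adj w v → ∀ k → w ! k ≤ 2 + u ! k
  near⇒≤2 uv wv k = ≤-trans (adj-≤ wv k) (s≤s (adj-≤ (Adj-sym uv) k))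

  near-straight : ∀ {j} → Adj u v → Adj w v → 2 + u ! j ≤ w ! j → ∀ k → k ≢ j → u ! k ≡ w ! k
  near-straight {j = j} uv@(adj a s eq) wv@(adj b s′ eq′) far k k≢j with j Fin.≟ a | j Fin.≟ b
  ... | yes refl | yes refl = trans (eq k k≢j) (sym (eq′ k k≢j))
  ... | no j≢a | _ = ⊥-elim (<⇒≱ far (≤-trans (adj-≤ wv j) (s≤s (≤-reflexive (sym (eq j j≢a))))))
  ... | _ | no j≢b = ⊥-elim (<⇒≱ far (≤-trans (≤-reflexive (eq′ j j≢b)) (adj-≤ (Adj-sym uv) j)))

  near-off : ∀ {i j} → Adj u v → Adj w v → i ≢ j → u ! i ≢ w ! i → u ! j ≢ w ! j →
    w ! i ≤ suc (u ! i) × w ! j ≤ suc (u ! j) × (∀ k → k ≢ i → k ≢ j → u ! k ≡ w ! k)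
  near-off {i = i} {j} uv@(adj a s eq) wv@(adj b s′ eq′) i≢j ui≢ uj≢
    with i Fin.≟ a | i Fin.≟ b | j Fin.≟ a | j Fin.≟ b
  ... | no i≢a | no i≢b | _ | _ = ⊥-elim (ui≢ (trans (eq i i≢a) (sym (eq′ i i≢b))))
  ... | _ | _ | no j≢a | no j≢b = ⊥-elim (uj≢ (trans (eq j j≢a) (sym (eq′ j j≢b))))
  ... | yes refl | _ | yes refl | _ = ⊥-elim (i≢j refl)
  ... | _ | yes refl | _ | yes refl = ⊥-elim (i≢j refl)
  ... | yes refl | no i≢b | no j≢a | yes refl =
    ≤-trans (≤-reflexive (eq′ i i≢b)) (adj-≤ (Adj-sym uv) i) ,
    ≤-trans (adj-≤ wv j) (s≤s (≤-reflexive (sym (eq j j≢a)))) ,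
    λ k k≢i k≢j → trans (eq k k≢i) (sym (eq′ k k≢j))
  ... | no i≢a | yes refl | yes refl | no j≢b =
    ≤-trans (adj-≤ wv i) (s≤s (≤-reflexive (sym (eq i i≢a)))) ,
    ≤-trans (≤-reflexive (eq′ j j≢b)) (adj-≤ (Adj-sym uv) j) ,
    λ k k≢i k≢j → trans (eq k k≢j) (sym (eq′ k k≢i))

  record Diagonal (i j : Fin d) (m p : Pt d) : Set where
    field
      i≢j  : i ≢ j
      at-i : p ! i ≡ suc (m ! i)
      at-j : p ! j ≡ suc (m ! j)
      at-k : ∀ k → k ≢ i → k ≢ j → p ! k ≡ m ! k

    m≤p : ∀ k → m ! k ≤ p ! k
    m≤p k with k Fin.≟ i | k Fin.≟ j
    ... | yes refl | _ = ≤-trans (n≤1+n _) (≤-reflexive (sym at-i))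
    ... | _ | yes refl = ≤-trans (n≤1+n _) (≤-reflexive (sym at-j))
    ... | no k≢i | no k≢j = ≤-reflexive (sym (at-k k k≢i k≢j))

    corner-contact : (∀ k → u ! k ≤ m ! k) → (∀ k → p ! k ≤ w ! k) → Adj u v → Adj w v → u ≡ m × w ≡ p
    corner-contact {u = u} {w = w} u≤m p≤w uv wv
      with near-off uv wv i≢j (<⇒≢ u<w-i) (<⇒≢ u<w-j)
      where
      u<w-i : u ! i < w ! i
      u<w-i = ≤-trans (s≤s (u≤m i)) (≤-trans (≤-reflexive (sym at-i)) (p≤w i))
      u<w-j : u ! j < w ! j
      u<w-j = ≤-trans (s≤s (u≤m j)) (≤-trans (≤-reflexive (sym at-j)) (p≤w j))
    ... | wi , wj , wk = lookup-ext (λ k → proj₁ (both k)) , lookup-ext (λ k → proj₂ (both k))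
      where
      pinch : ∀ {k} → p ! k ≡ suc (m ! k) → w ! k ≤ suc (u ! k) → u ! k ≡ m ! k × w ! k ≡ p ! k
      pinch {k} e w≤ =
        ≤-antisym (u≤m k) (≤-pred (≤-trans (≤-reflexive (sym e)) (≤-trans (p≤w k) w≤))) ,
        ≤-antisym (≤-trans w≤ (≤-trans (s≤s (u≤m k)) (≤-reflexive (sym e)))) (p≤w k)
      both : ∀ k → u ! k ≡ m ! k × w ! k ≡ p ! k
      both k with k Fin.≟ i | k Fin.≟ j
      ... | yes refl | _ = pinch at-i wi
      ... | _ | yes refl = pinch at-j wj
      ... | no k≢i | no k≢j =
        ≤-antisym (u≤m k) (≤-trans (≤-reflexive (sym (at-k k k≢i k≢j))) (≤-trans (p≤w k) (≤-reflexive (sym (wk k k≢i k≢j))))) ,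
        ≤-antisym (≤-trans (≤-reflexive (sym (wk k k≢i k≢j))) (≤-trans (u≤m k) (≤-reflexive (sym (at-k k k≢i k≢j))))) (p≤w k)

    corner-join : ∀ {lo hi} → Closed Adj S → Box lo m ⊆ S → Box p hi ⊆ S →
      (∀ k → lo ! k ≤ m ! k) → (∀ k → p ! k ≤ hi ! k) → Box lo hi ⊆ S
    corner-join {S = S} {lo = lo} {hi} cl box box′ lo≤m p≤hi =
      fill (join cl box box′ (upper∈Box lo≤m) (lower∈Box p≤hi) m≢p m~v p~v)
      where
      m≢p : m ≢ p
      m≢p refl = 1+n≢n (sym at-i)
      v₀ = m [ i ]≔ suc (m ! i)
      m~v : Adj m v₀
      m~v = adj i (inj₁ (sym (lookup∘update i m _))) λ k k≢i → sym (lookup∘update′ k≢i m _)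
      v₀-j : v₀ ! j ≡ m ! j
      v₀-j = lookup∘update′ (i≢j ∘ sym) m _
      p~v : Adj p v₀
      p~v = adj j (inj₂ (trans (cong suc v₀-j) (sym at-j))) other
        where
        other : ∀ k → k ≢ j → p ! k ≡ v₀ ! k
        other k k≢j with k Fin.≟ i
        ... | yes refl = trans at-i (sym (lookup∘update i m _))
        ... | no k≢i = trans (at-k k k≢i k≢j) (sym (lookup∘update′ k≢i m _))
      fill : Hull S lo m p hi → Box lo hi ⊆ S
      fill (hull ins ext ext′) b = ins (mkBox λ k →
          ≤-trans (proj₁ (at (ext (lower∈Box lo≤m)) k)) (proj₁ (at b k)) ,
          ≤-trans (proj₂ (at b k)) (proj₂ (at (ext′ (upper∈Box p≤hi)) k)))

  record Blocker (A : List (Pt d)) (lo hi x : Pt d) : Set₁ where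
    field
      K      : Pt d → Set
      closed : Closed Adj K
      rest   : ∀ {a} → a ∈ A → a ≢ x → K a
      K⊆Box  : K ⊆ Box lo hi
      lo∉K   : ¬ K lo
      hi∉K   : ¬ K hi

  record CriticalBox (lo hi : Pt d) (c : ℕ) : Set₁ where
    field
      A N      : List (Pt d)
      lo≤hi    : ∀ k → lo ! k ≤ hi ! k
      A⊆Box    : ∀ {x} → x ∈ A → Box lo hi x
      spans    : ∀ {S} → Closed Adj S → (∀ {x} → x ∈ A → S x) → Box lo hi ⊆ S
      N⊆A      : ∀ {x} → x ∈ N → x ∈ A
      N-unique : Unique N
      N-length : length N ≡ c
      blocker  : ∀ {x} → x ∈ N → Blocker A lo hi x

  single : (x : Pt d) → CriticalBox x x 1
  single x = record
    { A = [ x ] ; N = [ x ] ; lo≤hi = λ k → ≤-refl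
    ; A⊆Box = λ { (here refl) → mkBox λ k → ≤-refl , ≤-refl }
    ; spans = λ {S} cl A⊆S b → subst S (lookup-ext λ k → ≤-antisym (proj₁ (at b k)) (proj₂ (at b k))) (A⊆S (here refl))
    ; N⊆A = λ m → m ; N-unique = [] ∷ [] ; N-length = refl
    ; blocker = λ { (here refl) → record
        { K = λ _ → ⊥ ; closed = λ _ _ _ () ; rest = λ { (here refl) ne → ne refl }
        ; K⊆Box = λ () ; lo∉K = λ () ; hi∉K = λ () } }
    }

  -- The boxes [lo₁,hi₁] and [lo₂,hi₂] are translates along axis j. The triggers are p = hi₁ + eᵢ + eⱼ and
  -- q = lo₂ − eᵢ − eⱼ: each touches its own box in one corner only, and only the two boxes enlarged by
  -- p and q are close enough (distance 2) to merge, into [lo,hi].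
  record Layout (i j : Fin d) (lo₁ hi₁ lo₂ hi₂ p q lo hi : Pt d) : Set where
    field
      diag-p : Diagonal i j hi₁ p
      diag-q : Diagonal i j q lo₂
      gap    : q ! j ≡ 2 + p ! j
      lo-j   : lo ! j ≡ lo₁ ! j
      hi-j   : hi ! j ≡ hi₂ ! j
      lo-k   : ∀ k → k ≢ j → lo ! k ≡ q ! k
      hi-k   : ∀ k → k ≢ j → hi ! k ≡ p ! k
      lo₁≡lo₂ : ∀ k → k ≢ j → lo₁ ! k ≡ lo₂ ! k
      hi₁≡hi₂ : ∀ k → k ≢ j → hi₁ ! k ≡ hi₂ ! k

  module Merge {i j : Fin d} {lo₁ hi₁ lo₂ hi₂ p q lo hi : Pt d} {c₁ c₂ : ℕ}
    (lay : Layout i j lo₁ hi₁ lo₂ hi₂ p q lo hi) (G₁ : CriticalBox lo₁ hi₁ c₁) (G₂ : CriticalBox lo₂ hi₂ c₂) where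

    open Layout lay
    module P = Diagonal diag-p
    module Q = Diagonal diag-q
    module G₁ = CriticalBox G₁
    module G₂ = CriticalBox G₂
    open P using (i≢j)

    lo<lo₁-i : suc (lo ! i) ≡ lo₁ ! i
    lo<lo₁-i = trans (cong suc (lo-k i i≢j)) (trans (sym Q.at-i) (sym (lo₁≡lo₂ i i≢j)))

    hi₁<hi-i : hi ! i ≡ suc (hi₁ ! i)
    hi₁<hi-i = trans (hi-k i i≢j) P.at-i

    hi₂<hi-i : hi ! i ≡ suc (hi₂ ! i)
    hi₂<hi-i = trans hi₁<hi-i (cong suc (hi₁≡hi₂ i i≢j))

    q-j : q ! j ≡ 3 + hi₁ ! j
    q-j = trans gap (cong (2 +_) P.at-j)

    p<hi-j : p ! j < hi ! j
    p<hi-j = begin-strict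
      p ! j        <⟨ n<1+n _ ⟩
      suc (p ! j)  ≤⟨ n≤1+n _ ⟩
      2 + p ! j    ≡⟨ gap ⟨
      q ! j        ≤⟨ Q.m≤p j ⟩
      lo₂ ! j      ≤⟨ G₂.lo≤hi j ⟩
      hi₂ ! j      ≡⟨ hi-j ⟨
      hi ! j       ∎
      where open ≤-Reasoning

    lo<q-j : lo ! j < q ! j
    lo<q-j = begin-strict
      lo ! j     ≡⟨ lo-j ⟩
      lo₁ ! j    ≤⟨ G₁.lo≤hi j ⟩
      hi₁ ! j    ≤⟨ P.m≤p j ⟩
      p ! j      <⟨ n<1+n _ ⟩
      1 + p ! j  ≤⟨ n≤1+n _ ⟩
      2 + p ! j  ≡⟨ gap ⟨
      q ! j      ∎
      where open ≤-Reasoning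

    lo≤q : ∀ k → lo ! k ≤ q ! k
    lo≤q k with k Fin.≟ j
    ... | yes refl = <⇒≤ lo<q-j
    ... | no k≢j = ≤-reflexive (lo-k k k≢j)

    lo≤lo₁ : ∀ k → lo ! k ≤ lo₁ ! k
    lo≤lo₁ k with k Fin.≟ j
    ... | yes refl = ≤-reflexive lo-j
    ... | no k≢j = ≤-trans (≤-reflexive (lo-k k k≢j)) (≤-trans (Q.m≤p k) (≤-reflexive (sym (lo₁≡lo₂ k k≢j))))

    p≤hi : ∀ k → p ! k ≤ hi ! k
    p≤hi k with k Fin.≟ j
    ... | yes refl = <⇒≤ p<hi-j
    ... | no k≢j = ≤-reflexive (sym (hi-k k k≢j))

    hi₂≤hi : ∀ k → hi₂ ! k ≤ hi ! k
    hi₂≤hi k with k Fin.≟ j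
    ... | yes refl = ≤-reflexive (sym hi-j)
    ... | no k≢j = ≤-trans (≤-reflexive (sym (hi₁≡hi₂ k k≢j))) (≤-trans (P.m≤p k) (≤-reflexive (sym (hi-k k k≢j))))

    q≤hi₂ : ∀ k → q ! k ≤ hi₂ ! k
    q≤hi₂ k = ≤-trans (Q.m≤p k) (G₂.lo≤hi k)

    lo₁≤p : ∀ k → lo₁ ! k ≤ p ! k
    lo₁≤p k = ≤-trans (G₁.lo≤hi k) (P.m≤p k)

    Box₁⊆ : Box lo₁ hi₁ ⊆ Box lo₁ p
    Box₁⊆ b = mkBox λ k → proj₁ (at b k) , ≤-trans (proj₂ (at b k)) (P.m≤p k)

    Box₂⊆ : Box lo₂ hi₂ ⊆ Box q hi₂
    Box₂⊆ b = mkBox λ k → ≤-trans (Q.m≤p k) (proj₁ (at b k)) , proj₂ (at b k)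

    Box₁p⊆ : Box lo₁ p ⊆ Box lo hi
    Box₁p⊆ b = mkBox λ k → ≤-trans (lo≤lo₁ k) (proj₁ (at b k)) , ≤-trans (proj₂ (at b k)) (p≤hi k)

    Box₂q⊆ : Box q hi₂ ⊆ Box lo hi
    Box₂q⊆ b = mkBox λ k → ≤-trans (lo≤q k) (proj₁ (at b k)) , ≤-trans (proj₂ (at b k)) (hi₂≤hi k)

    p∈ : Box p p p
    p∈ = mkBox λ k → ≤-refl , ≤-refl
    q∈ : Box q q q
    q∈ = mkBox λ k → ≤-refl , ≤-refl

    pp⊆ : Box p p ⊆ Box lo₁ p
    pp⊆ b = mkBox λ k → ≤-trans (lo₁≤p k) (proj₁ (at b k)) , proj₂ (at b k)
    qq⊆ : Box q q ⊆ Box q hi₂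
    qq⊆ b = mkBox λ k → proj₁ (at b k) , ≤-trans (proj₂ (at b k)) (q≤hi₂ k)

    A : List (Pt d)
    A = p ∷ q ∷ G₁.A ++ G₂.A

    A⊆Box : ∀ {x} → x ∈ A → Box lo hi x
    A⊆Box (here refl) = Box₁p⊆ (pp⊆ p∈)
    A⊆Box (there (here refl)) = Box₂q⊆ (qq⊆ q∈)
    A⊆Box (there (there x∈)) with ∈-++⁻ G₁.A x∈
    ... | inj₁ x∈₁ = Box₁p⊆ (Box₁⊆ (G₁.A⊆Box x∈₁))
    ... | inj₂ x∈₂ = Box₂q⊆ (Box₂⊆ (G₂.A⊆Box x∈₂))

    spans : Closed Adj S → (∀ {x} → x ∈ A → S x) → Box lo hi ⊆ S
    spans {S = S} cl A⊆S = fill (join cl box₁ box₂ u∈ w∈ u≢w u~v w~v)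
      where
      pt : Box p p ⊆ S
      pt b = subst S (lookup-ext λ k → ≤-antisym (proj₁ (at b k)) (proj₂ (at b k))) (A⊆S (here refl))
      qt : Box q q ⊆ S
      qt b = subst S (lookup-ext λ k → ≤-antisym (proj₁ (at b k)) (proj₂ (at b k))) (A⊆S (there (here refl)))
      box₁ : Box lo₁ p ⊆ S
      box₁ = P.corner-join cl (G₁.spans cl λ m → A⊆S (there (there (∈-++⁺ˡ m)))) pt G₁.lo≤hi (λ k → ≤-refl)
      box₂ : Box q hi₂ ⊆ S
      box₂ = Q.corner-join cl qt (G₂.spans cl λ m → A⊆S (there (there (∈-++⁺ʳ G₁.A m)))) (λ k → ≤-refl) G₂.lo≤hi
      u₀ = hi₁ [ j ]≔ p ! j
      v₀ = hi₁ [ j ]≔ suc (p ! j)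
      w₀ = hi₁ [ j ]≔ q ! j
      u∈ : Box lo₁ p u₀
      u∈ .at k with k Fin.≟ j
      ... | yes refl rewrite lookup∘update j hi₁ (p ! j) = lo₁≤p j , ≤-refl
      ... | no k≢j rewrite lookup∘update′ k≢j hi₁ (p ! j) = G₁.lo≤hi k , P.m≤p k
      w∈ : Box q hi₂ w₀
      w∈ .at k with k Fin.≟ j
      ... | yes refl rewrite lookup∘update j hi₁ (q ! j) = ≤-refl , q≤hi₂ j
      ... | no k≢j rewrite lookup∘update′ k≢j hi₁ (q ! j) =
        ≤-trans (q≤hi₂ k) (≤-reflexive (sym (hi₁≡hi₂ k k≢j))) , ≤-reflexive (hi₁≡hi₂ k k≢j)
      u≢w : u₀ ≢ w₀
      u≢w e = <⇒≢ (≤-trans (n≤1+n _) (≤-reflexive (sym gap)))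
        (trans (sym (lookup∘update j hi₁ (p ! j))) (trans (cong (_! j) e) (lookup∘update j hi₁ (q ! j))))
      u~v : Adj u₀ v₀
      u~v = adj j (subst₂ Step (sym (lookup∘update j hi₁ _)) (sym (lookup∘update j hi₁ _)) (inj₁ refl))
        λ k k≢j → trans (lookup∘update′ k≢j hi₁ _) (sym (lookup∘update′ k≢j hi₁ _))
      w~v : Adj w₀ v₀
      w~v = adj j (subst₂ Step (sym (lookup∘update j hi₁ _)) (sym (lookup∘update j hi₁ _)) (inj₂ (sym gap)))
        λ k k≢j → trans (lookup∘update′ k≢j hi₁ _) (sym (lookup∘update′ k≢j hi₁ _))
      fill : Hull S lo₁ p q hi₂ → Box lo hi ⊆ S
      fill (hull {lower} {upper} ins ext ext′) b = ins (mkBox λ k → ≤-trans (lower≤ k) (proj₁ (at b k)) , ≤-trans (proj₂ (at b k)) (≤upper k))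
        where
        lower≤ : ∀ k → lower ! k ≤ lo ! k
        lower≤ k with k Fin.≟ j
        ... | yes refl = ≤-trans (proj₁ (at (ext (lower∈Box lo₁≤p)) j)) (≤-reflexive (sym lo-j))
        ... | no k≢j = ≤-trans (proj₁ (at (ext′ (qq⊆ q∈)) k)) (≤-reflexive (sym (lo-k k k≢j)))
        ≤upper : ∀ k → hi ! k ≤ upper ! k
        ≤upper k with k Fin.≟ j
        ... | yes refl = ≤-trans (≤-reflexive hi-j) (proj₂ (at (ext′ (upper∈Box q≤hi₂)) j))
        ... | no k≢j = ≤-trans (≤-reflexive (hi-k k k≢j)) (proj₂ (at (ext (pp⊆ p∈)) k))

    far-across : Far (Box lo₁ hi₁) (Box q hi₂)
    far-across {u = u} {w} bu bw uv wv = <⇒≱ (s≤s (near⇒≤2 uv wv j)) (begin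
      3 + u ! j    ≤⟨ +-monoʳ-≤ 3 (proj₂ (at bu j)) ⟩
      3 + hi₁ ! j  ≡⟨ q-j ⟨
      q ! j        ≤⟨ proj₁ (at bw j) ⟩
      w ! j        ∎)
      where open ≤-Reasoning

    far-across′ : Far (Box lo₁ p) (Box lo₂ hi₂)
    far-across′ {u = u} {w} bu bw uv wv = <⇒≱ (s≤s (near⇒≤2 uv wv j)) (begin
      3 + u ! j    ≤⟨ +-monoʳ-≤ 3 (proj₂ (at bu j)) ⟩
      3 + p ! j    ≡⟨ cong suc gap ⟨
      1 + q ! j    ≡⟨ Q.at-j ⟨
      lo₂ ! j      ≤⟨ proj₁ (at bw j) ⟩
      w ! j        ∎)
      where open ≤-Reasoning

    -- In axis j the two sets are only 2 apart; they are separated by axis i.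
    far-p : Far (Box p p) (Box q hi₂)
    far-p {u = u} {w} bu bw uv wv = <⇒≢ lt (sym (near-straight uv wv two i i≢j))
      where
      open ≤-Reasoning
      two : 2 + u ! j ≤ w ! j
      two = begin
        2 + u ! j ≤⟨ +-monoʳ-≤ 2 (proj₂ (at bu j)) ⟩
        2 + p ! j ≡⟨ gap ⟨
        q ! j     ≤⟨ proj₁ (at bw j) ⟩
        w ! j     ∎
      lt : w ! i < u ! i
      lt = begin-strict
        w ! i       ≤⟨ proj₂ (at bw i) ⟩
        hi₂ ! i     ≡⟨ hi₁≡hi₂ i i≢j ⟨
        hi₁ ! i     <⟨ n<1+n _ ⟩
        1 + hi₁ ! i ≡⟨ P.at-i ⟨
        p ! i       ≤⟨ proj₁ (at bu i) ⟩
        u ! i       ∎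

    far-q : Far (Box lo₁ p) (Box q q)
    far-q {u = u} {w} bu bw uv wv = <⇒≢ lt (sym (near-straight uv wv two i i≢j))
      where
      open ≤-Reasoning
      two : 2 + u ! j ≤ w ! j
      two = begin
        2 + u ! j ≤⟨ +-monoʳ-≤ 2 (proj₂ (at bu j)) ⟩
        2 + p ! j ≡⟨ gap ⟨
        q ! j     ≤⟨ proj₁ (at bw j) ⟩
        w ! j     ∎
      lt : w ! i < u ! i
      lt = begin-strict
        w ! i       ≤⟨ proj₂ (at bw i) ⟩
        q ! i       <⟨ n<1+n _ ⟩
        1 + q ! i   ≡⟨ Q.at-i ⟨
        lo₂ ! i     ≡⟨ lo₁≡lo₂ i i≢j ⟨
        lo₁ ! i     ≤⟨ proj₁ (at bu i) ⟩
        u ! i       ∎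

    lo∉₁p : ¬ Box lo₁ p lo
    lo∉₁p b = <⇒≱ (≤-reflexive lo<lo₁-i) (proj₁ (at b i))
    lo∉₂q : ¬ Box q hi₂ lo
    lo∉₂q b = <⇒≱ lo<q-j (proj₁ (at b j))
    hi∉₁p : ¬ Box lo₁ p hi
    hi∉₁p b = <⇒≱ p<hi-j (proj₂ (at b j))
    hi∉₂q : ¬ Box q hi₂ hi
    hi∉₂q b = <⇒≱ (≤-reflexive (sym hi₂<hi-i)) (proj₂ (at b i))

    blocker₁ : ∀ {x} → x ∈ G₁.N → Blocker A lo hi x
    blocker₁ {x} x∈ = record
      { K = K ∪ (Box p p ∪ Box q hi₂)
      ; closed = closed-∪ closed (closed-∪ closed-box closed-box far-p)
          (Far-∪ far-corner (λ Ku → far-across (K⊆Box Ku)))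
      ; rest = others
      ; K⊆Box = [ (λ Ku → Box₁p⊆ (Box₁⊆ (K⊆Box Ku))) , [ (λ b → Box₁p⊆ (pp⊆ b)) , Box₂q⊆ ]′ ]′
      ; lo∉K = [ (λ Ku → lo∉₁p (Box₁⊆ (K⊆Box Ku))) , [ (λ b → lo∉₁p (pp⊆ b)) , lo∉₂q ]′ ]′
      ; hi∉K = [ (λ Ku → hi∉₁p (Box₁⊆ (K⊆Box Ku))) , [ (λ b → hi∉₁p (pp⊆ b)) , hi∉₂q ]′ ]′
      }
      where
      open Blocker (G₁.blocker x∈)
      far-corner : Far K (Box p p)
      far-corner Ku bw uv wv = hi∉K (subst K (proj₁ (P.corner-contact
        (λ k → proj₂ (at (K⊆Box Ku) k)) (λ k → proj₁ (at bw k)) uv wv)) Ku)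
      others : ∀ {a} → a ∈ A → a ≢ x → (K ∪ (Box p p ∪ Box q hi₂)) a
      others (here refl) _ = inj₂ (inj₁ p∈)
      others (there (here refl)) _ = inj₂ (inj₂ (qq⊆ q∈))
      others (there (there a∈)) a≢x with ∈-++⁻ G₁.A a∈
      ... | inj₁ a∈₁ = inj₁ (rest a∈₁ a≢x)
      ... | inj₂ a∈₂ = inj₂ (inj₂ (Box₂⊆ (G₂.A⊆Box a∈₂)))

    blocker₂ : ∀ {x} → x ∈ G₂.N → Blocker A lo hi x
    blocker₂ {x} x∈ = record
      { K = Box lo₁ p ∪ (Box q q ∪ K)
      ; closed = closed-∪ closed-box (closed-∪ closed-box closed far-corner)
          (Far-∪ far-q (λ bu Kw → far-across′ bu (K⊆Box Kw)))
      ; rest = others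
      ; K⊆Box = [ Box₁p⊆ , [ (λ b → Box₂q⊆ (qq⊆ b)) , (λ Ku → Box₂q⊆ (Box₂⊆ (K⊆Box Ku))) ]′ ]′
      ; lo∉K = [ lo∉₁p , [ (λ b → lo∉₂q (qq⊆ b)) , (λ Ku → lo∉₂q (Box₂⊆ (K⊆Box Ku))) ]′ ]′
      ; hi∉K = [ hi∉₁p , [ (λ b → hi∉₂q (qq⊆ b)) , (λ Ku → hi∉₂q (Box₂⊆ (K⊆Box Ku))) ]′ ]′
      }
      where
      open Blocker (G₂.blocker x∈)
      far-corner : Far (Box q q) K
      far-corner bu Kw uv wv = lo∉K (subst K (proj₂ (Q.corner-contact
        (λ k → proj₂ (at bu k)) (λ k → proj₁ (at (K⊆Box Kw) k)) uv wv)) Kw)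
      others : ∀ {a} → a ∈ A → a ≢ x → (Box lo₁ p ∪ (Box q q ∪ K)) a
      others (here refl) _ = inj₁ (pp⊆ p∈)
      others (there (here refl)) _ = inj₂ (inj₁ q∈)
      others (there (there a∈)) a≢x with ∈-++⁻ G₁.A a∈
      ... | inj₁ a∈₁ = inj₁ (Box₁⊆ (G₁.A⊆Box a∈₁))
      ... | inj₂ a∈₂ = inj₂ (inj₂ (rest a∈₂ a≢x))

    N : List (Pt d)
    N = G₁.N ++ G₂.N

    disjoint : ∀ {x} → ¬ (x ∈ G₁.N × x ∈ G₂.N)
    disjoint (x∈₁ , x∈₂) = <⇒≱ hi₁<lo₂ (≤-trans (proj₁ (at (G₂.A⊆Box (G₂.N⊆A x∈₂)) j)) (proj₂ (at (G₁.A⊆Box (G₁.N⊆A x∈₁)) j)))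
      where
      hi₁<lo₂ : hi₁ ! j < lo₂ ! j
      hi₁<lo₂ = ≤-trans (≤-trans (m≤n+m (suc (hi₁ ! j)) 2) (≤-reflexive (sym q-j))) (Q.m≤p j)

    merged : CriticalBox lo hi (c₁ + c₂)
    merged = record
      { A = A ; N = N
      ; lo≤hi = λ k → ≤-trans (lo≤q k) (≤-trans (q≤hi₂ k) (hi₂≤hi k))
      ; A⊆Box = A⊆Box ; spans = spans
      ; N⊆A = λ x∈ → there (there ([ (λ m → ∈-++⁺ˡ (G₁.N⊆A m)) , (λ m → ∈-++⁺ʳ G₁.A (G₂.N⊆A m)) ]′ (∈-++⁻ G₁.N x∈)))
      ; N-unique = Unique.++⁺ G₁.N-unique G₂.N-unique disjoint
      ; N-length = trans (length-++ G₁.N) (cong₂ _+_ G₁.N-length G₂.N-length)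
      ; blocker = λ x∈ → [ blocker₁ , blocker₂ ]′ (∈-++⁻ G₁.N x∈)
      }

  -- Doubling

  _⊕_ : Pt d → Pt d → Pt d
  _⊕_ = zipWith _+_

  ⊕-at : (u v : Pt d) → ∀ k → (u ⊕ v) ! k ≡ u ! k + v ! k
  ⊕-at u v k = lookup-zipWith _+_ k u v

  bump : Fin d → Pt d → Pt d
  bump i v = updateAt v i suc

  bump-diagonal : {i j : Fin d} → i ≢ j → (m : Pt d) → Diagonal i j m (bump i (bump j m))
  bump-diagonal {i = i} {j} i≢j m = record
    { i≢j = i≢j
    ; at-i = trans (lookup∘updateAt i (bump j m)) (cong suc (lookup∘updateAt′ i j i≢j m))
    ; at-j = trans (lookup∘updateAt′ j i (i≢j ∘ sym) (bump j m)) (lookup∘updateAt j m)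
    ; at-k = λ k k≢i k≢j → trans (lookup∘updateAt′ k i k≢i (bump j m)) (lookup∘updateAt′ k j k≢j m)
    }

  double : Fin d → Fin d → Pt d → Pt d
  double i j h = updateAt (updateAt h i (2 +_)) j (λ x → 4 + (x + x))

  double-j : {i j : Fin d} → i ≢ j → (h : Pt d) → double i j h ! j ≡ 4 + (h ! j + h ! j)
  double-j {i = i} {j} i≢j h = trans (lookup∘updateAt j (updateAt h i (2 +_))) (cong (λ x → 4 + (x + x)) (lookup∘updateAt′ j i (i≢j ∘ sym) h))

  double-i : {i j : Fin d} → i ≢ j → (h : Pt d) → double i j h ! i ≡ 2 + h ! i
  double-i {i = i} {j} i≢j h = trans (lookup∘updateAt′ i j i≢j (updateAt h i (2 +_))) (lookup∘updateAt i h)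

  double-k : {i j : Fin d} (h : Pt d) → ∀ k → k ≢ i → k ≢ j → double i j h ! k ≡ h ! k
  double-k {i = i} {j} h k k≢i k≢j = trans (lookup∘updateAt′ k j k≢j (updateAt h i (2 +_))) (lookup∘updateAt′ k i k≢i h)

  double-critical : {i j : Fin d} → i ≢ j → (h : Pt d) →
    (∀ lo → CriticalBox lo (lo ⊕ h) c) → ∀ lo → CriticalBox lo (lo ⊕ double i j h) (c + c)
  double-critical {i = i} {j} i≢j h crit lo = Merge.merged layout (crit lo₁) (crit lo₂)
    where
    lo₁ = bump i lo
    hi₁ = lo₁ ⊕ h
    p = bump i (bump j hi₁)
    q = lo [ j ]≔ (2 + p ! j)
    lo₂ = bump i (bump j q)
    hi₂ = lo₂ ⊕ h
    module P = Diagonal (bump-diagonal i≢j hi₁)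
    module Q = Diagonal (bump-diagonal i≢j q)
    open ≡-Reasoning
    q-j : q ! j ≡ 2 + p ! j
    q-j = lookup∘update j lo _
    q-k : ∀ k → k ≢ j → q ! k ≡ lo ! k
    q-k k k≢j = lookup∘update′ k≢j lo _
    lo₁-j : lo₁ ! j ≡ lo ! j
    lo₁-j = lookup∘updateAt′ j i (i≢j ∘ sym) lo
    lo₁≡lo₂ : ∀ k → k ≢ j → lo₁ ! k ≡ lo₂ ! k
    lo₁≡lo₂ k k≢j with k Fin.≟ i
    ... | yes refl = trans (lookup∘updateAt i lo) (sym (trans Q.at-i (cong suc (q-k i i≢j))))
    ... | no k≢i = trans (lookup∘updateAt′ k i k≢i lo) (sym (trans (Q.at-k k k≢i k≢j) (q-k k k≢j)))
    hi-k : ∀ k → k ≢ j → (lo ⊕ double i j h) ! k ≡ p ! k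
    hi-k k k≢j with k Fin.≟ i
    ... | yes refl = begin
      (lo ⊕ double i j h) ! i  ≡⟨ ⊕-at lo _ i ⟩
      lo ! i + double i j h ! i ≡⟨ cong (lo ! i +_) (double-i i≢j h) ⟩
      lo ! i + (2 + h ! i)      ≡⟨ shift (lo ! i) (h ! i) ⟩
      suc (suc (lo ! i) + h ! i) ≡⟨ cong (λ t → suc (t + h ! i)) (lookup∘updateAt i lo) ⟨
      suc (lo₁ ! i + h ! i)     ≡⟨ cong suc (⊕-at lo₁ h i) ⟨
      suc (hi₁ ! i)             ≡⟨ P.at-i ⟨
      p ! i                     ∎
      where
      shift : ∀ a b → a + (2 + b) ≡ suc (suc a + b)
      shift = solve-∀
    ... | no k≢i = begin
      (lo ⊕ double i j h) ! k  ≡⟨ ⊕-at lo _ k ⟩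
      lo ! k + double i j h ! k ≡⟨ cong₂ _+_ (sym (lookup∘updateAt′ k i k≢i lo)) (double-k h k k≢i k≢j) ⟩
      lo₁ ! k + h ! k           ≡⟨ ⊕-at lo₁ h k ⟨
      hi₁ ! k                   ≡⟨ P.at-k k k≢i k≢j ⟨
      p ! k                     ∎
    hi-j : (lo ⊕ double i j h) ! j ≡ hi₂ ! j
    hi-j = begin
      (lo ⊕ double i j h) ! j          ≡⟨ ⊕-at lo _ j ⟩
      lo ! j + double i j h ! j        ≡⟨ cong₂ _+_ (sym lo₁-j) (double-j i≢j h) ⟩
      lo₁ ! j + (4 + (h ! j + h ! j))  ≡⟨ shift (lo₁ ! j) (h ! j) ⟩
      suc (2 + suc (lo₁ ! j + h ! j)) + h ! j ≡⟨ cong (λ t → suc (2 + suc t) + h ! j) (⊕-at lo₁ h j) ⟨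
      suc (2 + suc (hi₁ ! j)) + h ! j  ≡⟨ cong (λ t → suc (2 + t) + h ! j) P.at-j ⟨
      suc (2 + p ! j) + h ! j          ≡⟨ cong (λ t → suc t + h ! j) q-j ⟨
      suc (q ! j) + h ! j              ≡⟨ cong (_+ h ! j) Q.at-j ⟨
      lo₂ ! j + h ! j                  ≡⟨ ⊕-at lo₂ h j ⟨
      hi₂ ! j                          ∎
      where
      shift : ∀ a b → a + (4 + (b + b)) ≡ suc (2 + suc (a + b)) + b
      shift = solve-∀
    layout : Layout i j lo₁ hi₁ lo₂ hi₂ p q lo (lo ⊕ double i j h)
    layout = record
      { diag-p = bump-diagonal i≢j hi₁
      ; diag-q = bump-diagonal i≢j q
      ; gap = q-j
      ; lo-j = sym lo₁-j
      ; hi-j = hi-j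
      ; lo-k = λ k k≢j → sym (q-k k k≢j)
      ; hi-k = hi-k
      ; lo₁≡lo₂ = lo₁≡lo₂
      ; hi₁≡hi₂ = λ k k≢j → trans (⊕-at lo₁ h k) (trans (cong (_+ h ! k) (lo₁≡lo₂ k k≢j)) (sym (⊕-at lo₂ h k)))
      }

  aux : Fin (2 + d) → Fin (2 + d)
  aux zero = suc zero
  aux (suc _) = zero

  aux≢ : (j : Fin (2 + d)) → aux j ≢ j
  aux≢ zero ()
  aux≢ (suc _) ()

  doubleAll : List (Fin (2 + d)) → Pt (2 + d) → Pt (2 + d)
  doubleAll [] h = h
  doubleAll (j ∷ js) h = doubleAll js (double (aux j) j h)

  doubleAll-critical : (js : List (Fin (2 + d))) (h : Pt (2 + d)) →
    (∀ lo → CriticalBox lo (lo ⊕ h) c) → ∀ lo → CriticalBox lo (lo ⊕ doubleAll js h) (2 ^ length js * c)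
  doubleAll-critical {c = c} [] h crit lo = subst (CriticalBox lo _) (sym (*-identityˡ c)) (crit lo)
  doubleAll-critical {c = c} (j ∷ js) h crit lo =
    subst (CriticalBox lo _) (eq (2 ^ length js) c) (doubleAll-critical js _ (double-critical (aux≢ j) h crit) lo)
    where
    eq : ∀ a c → a * (c + c) ≡ 2 * a * c
    eq = solve-∀

  double-≤ : {i j : Fin d} → i ≢ j → (h : Pt d) → ∀ k → k ≢ j → double i j h ! k ≤ 2 + h ! k
  double-≤ {i = i} i≢j h k k≢j with k Fin.≟ i
  ... | yes refl = ≤-reflexive (double-i i≢j h)
  ... | no k≢i = ≤-trans (≤-reflexive (double-k h k k≢i k≢j)) (m≤n+m _ 2)

  doubleAll-∉ : (js : List (Fin (2 + d))) (h : Pt (2 + d)) → ∀ k → k ∉ js →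
    doubleAll js h ! k ≤ length js * 2 + h ! k
  doubleAll-∉ [] h k _ = ≤-refl
  doubleAll-∉ (j ∷ js) h k k∉ = begin
    doubleAll js _ ! k                     ≤⟨ doubleAll-∉ js _ k (k∉ ∘ there) ⟩
    length js * 2 + double (aux j) j h ! k ≤⟨ +-monoʳ-≤ (length js * 2) (double-≤ (aux≢ j) h k (k∉ ∘ here)) ⟩
    length js * 2 + (2 + h ! k)            ≡⟨ eq (length js) (h ! k) ⟩
    2 + length js * 2 + h ! k              ∎
    where
    open ≤-Reasoning
    eq : ∀ a b → a * 2 + (2 + b) ≡ 2 + a * 2 + b
    eq = solve-∀

  doubleAll-≤ : (js : List (Fin (2 + d))) (h : Pt (2 + d)) → Unique js → ∀ k →
    doubleAll js h ! k ≤ 4 + length js * 4 + (h ! k + h ! k)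
  doubleAll-≤ [] h _ k = ≤-trans (m≤m+n (h ! k) (h ! k)) (m≤n+m _ 4)
  doubleAll-≤ (j ∷ js) h (j∉ ∷ uniq) k with k Fin.≟ j
  ... | yes refl = begin
    doubleAll js _ ! j                      ≤⟨ doubleAll-∉ js _ j (All¬⇒¬Any j∉) ⟩
    length js * 2 + double (aux j) j h ! j  ≡⟨ cong (length js * 2 +_) (double-j (aux≢ j) h) ⟩
    length js * 2 + (4 + (h ! j + h ! j))   ≤⟨ m≤m+n _ (4 + length js * 2) ⟩
    length js * 2 + (4 + (h ! j + h ! j)) + (4 + length js * 2) ≡⟨ eq (length js) (h ! j) ⟩
    4 + (4 + length js * 4) + (h ! j + h ! j) ∎
    where
    open ≤-Reasoning
    eq : ∀ a b → a * 2 + (4 + (b + b)) + (4 + a * 2) ≡ 4 + (4 + a * 4) + (b + b)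
    eq = solve-∀
  ... | no k≢j = begin
    doubleAll js _ ! k                      ≤⟨ doubleAll-≤ js _ uniq k ⟩
    4 + length js * 4 + (x + x)             ≤⟨ +-monoʳ-≤ (4 + length js * 4) (+-mono-≤ x≤ x≤) ⟩
    4 + length js * 4 + (2 + h ! k + (2 + h ! k)) ≡⟨ eq (length js) (h ! k) ⟩
    4 + (4 + length js * 4) + (h ! k + h ! k) ∎
    where
    open ≤-Reasoning
    x = double (aux j) j h ! k
    x≤ : x ≤ 2 + h ! k
    x≤ = double-≤ (aux≢ j) h k k≢j
    eq : ∀ a b → 4 + a * 4 + (2 + b + (2 + b)) ≡ 4 + (4 + a * 4) + (b + b)
    eq = solve-∀

  -- Doubling an axis lengthens the auxiliary axis, and later doublings multiply that excess. Doubling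
  -- every axis once per round keeps all sides O(2 ^ m) after m rounds.
  size : ∀ d → ℕ → Pt (2 + d)
  size d zero = replicate (2 + d) 0
  size d (suc m) = doubleAll (allFin (2 + d)) (size d m)

  size-critical : ∀ d m lo → CriticalBox lo (lo ⊕ size d m) ((2 ^ (2 + d)) ^ m)
  size-critical d zero lo = subst (λ hi → CriticalBox lo hi 1) (sym eq) (single lo)
    where
    eq : lo ⊕ size d zero ≡ lo
    eq = lookup-ext λ k → trans (⊕-at lo _ k) (trans (cong (lo ! k +_) (lookup-replicate k 0)) (+-identityʳ _))
  size-critical d (suc m) lo =
    subst (λ t → CriticalBox lo (lo ⊕ size d (suc m)) (2 ^ t * (2 ^ (2 + d)) ^ m)) (length-tabulate {n = 2 + d} id)
      (doubleAll-critical (allFin (2 + d)) (size d m) (size-critical d m) lo)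

  scale : ℕ → ℕ
  scale d = 4 + d * 4

  size-≤ : ∀ d m k → scale (2 + d) + size d m ! k ≤ scale (2 + d) * 2 ^ m
  size-≤ d zero k = ≤-reflexive (trans (cong (scale (2 + d) +_) (lookup-replicate k 0))
    (trans (+-identityʳ _) (sym (*-identityʳ _))))
  size-≤ d (suc m) k = begin
    D + size d (suc m) ! k   ≤⟨ +-monoʳ-≤ D (doubleAll-≤ (allFin (2 + d)) (size d m) (Unique.allFin⁺ (2 + d)) k) ⟩
    D + (4 + length (allFin (2 + d)) * 4 + (s + s)) ≡⟨ cong (λ t → D + (4 + t * 4 + (s + s))) (length-tabulate {n = 2 + d} id) ⟩
    D + (D + (s + s))        ≡⟨ eq D s ⟩
    2 * (D + s)              ≤⟨ *-monoʳ-≤ 2 (size-≤ d m k) ⟩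
    2 * (D * 2 ^ m)          ≡⟨ eq′ D (2 ^ m) ⟩
    D * (2 * 2 ^ m)          ∎
    where
    open ≤-Reasoning
    D = scale (2 + d)
    s = size d m ! k
    eq : ∀ a b → a + (a + (b + b)) ≡ 2 * (a + b)
    eq = solve-∀
    eq′ : ∀ a b → 2 * (a * b) ≡ a * (2 * b)
    eq′ = solve-∀

  -- Minimal percolating subsets of finite graphs

  unique-⊆⇒length≤ : {V : Set} {xs ys : List V} → Unique xs → (∀ {x} → x ∈ xs → x ∈ ys) → length xs ≤ length ys
  unique-⊆⇒length≤ {xs = []} _ _ = z≤n
  unique-⊆⇒length≤ {xs = x ∷ xs} (x∉ ∷ uniq) xs⊆ys with ∈-∃++ (xs⊆ys (here refl))
  ... | as , bs , refl = ≤-trans (s≤s (unique-⊆⇒length≤ uniq xs⊆as++bs)) (≤-reflexive len)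
    where
    xs⊆as++bs : ∀ {y} → y ∈ xs → y ∈ as ++ bs
    xs⊆as++bs y∈ with ∈-++⁻ as (xs⊆ys (there y∈))
    ... | inj₁ y∈as = ∈-++⁺ˡ y∈as
    ... | inj₂ (here refl) = ⊥-elim (All¬⇒¬Any x∉ y∈)
    ... | inj₂ (there y∈bs) = ∈-++⁺ʳ as y∈bs
    len : suc (length (as ++ bs)) ≡ length (as ++ x ∷ bs)
    len = trans (cong suc (length-++ as)) (trans (sym (+-suc _ _)) (sym (length-++ as)))

  module _ {V : Set} {Adj : V → V → Set} where

    infected⇒closed : ∀ {A} {K : V → Set} → Closed Adj K → (∀ {x} → x ∈ A → K x) →
      ∀ {v} → Infected Adj 2 A v → K v
    infected⇒closed cl A⊆K (initial v∈A) = A⊆K v∈A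
    infected⇒closed cl A⊆K (spread (u ∷ w ∷ _) ((u≢w ∷ _) ∷ _) _ (uv ∷ wv ∷ _) (iu ∷ iw ∷ _)) =
      cl u≢w uv wv (infected⇒closed cl A⊆K iu) (infected⇒closed cl A⊆K iw)
    infected⇒closed cl A⊆K (spread (_ ∷ []) _ (s≤s ()) _ _)

    closed-infected : ∀ {A} → Closed Adj (Infected Adj 2 A)
    closed-infected u≢w uv wv iu iw =
      spread _ ((u≢w ∷ []) ∷ [] ∷ []) (s≤s (s≤s z≤n)) (uv ∷ wv ∷ []) (iu ∷ iw ∷ [])

    module Finite (_≟_ : DecidableEquality V) (Adj? : Decidable Adj) (vs : List V) (∈-vs : ∀ v → v ∈ vs) where
      open DecMembership _≟_ using (_∈?_)

      Saturation : List V → Set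
      Saturation A = Σ (List V) λ L →
        (∀ {x} → x ∈ A → x ∈ L) × (∀ {x} → x ∈ L → Infected Adj 2 A x) × Closed Adj (_∈ L)

      saturate-from : ∀ {A} fuel R L → length R ≤ fuel → (∀ v → v ∈ L ⊎ v ∈ R) →
        (∀ {x} → x ∈ A → x ∈ L) → (∀ {x} → x ∈ L → Infected Adj 2 A x) → Saturation A
      saturate-from {A} fuel R L len covered A⊆L L⊆I
        with any? (λ v → any? (λ u → any? (λ w → ¬? (u ≟ w) ×-dec Adj? u v ×-dec Adj? w v) L) L) R
      ... | no none = L , A⊆L , L⊆I , cl
        where
        cl : Closed Adj (_∈ L)
        cl {v = v} u≢w uv wv u∈ w∈ with covered v
        ... | inj₁ v∈L = v∈L
        ... | inj₂ v∈R = ⊥-elim (none (lose v∈R (lose u∈ (lose w∈ (u≢w , uv , wv)))))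
      saturate-from zero [] L len covered A⊆L L⊆I | yes ()
      saturate-from {A} (suc fuel) R L len covered A⊆L L⊆I | yes some
        with find some
      ... | v , v∈R , some′ with find some′
      ... | u , u∈L , some″ with find some″
      ... | w , w∈L , u≢w , uv , wv =
        saturate-from fuel (filter (λ x → ¬? (x ≟ v)) R) (v ∷ L)
          (≤-pred (≤-trans (filter-notAll (λ x → ¬? (x ≟ v)) R (lose v∈R (λ v≢v → v≢v refl))) len))
          covered′ (there ∘ A⊆L) L′⊆I
        where
        covered′ : ∀ x → x ∈ v ∷ L ⊎ x ∈ filter (λ x → ¬? (x ≟ v)) R
        covered′ x with x ≟ v | covered x
        ... | yes refl | _ = inj₁ (here refl)
        ... | no x≢v | inj₁ x∈L = inj₁ (there x∈L)
        ... | no x≢v | inj₂ x∈R = inj₂ (∈-filter⁺ (λ x → ¬? (x ≟ v)) x∈R x≢v)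
        L′⊆I : ∀ {x} → x ∈ v ∷ L → Infected Adj 2 A x
        L′⊆I (here refl) = closed-infected u≢w uv wv (L⊆I u∈L) (L⊆I w∈L)
        L′⊆I (there x∈L) = L⊆I x∈L

      saturate : ∀ A → Saturation A
      saturate A = saturate-from (length vs) vs A ≤-refl (inj₂ ∘ ∈-vs) (λ x∈ → x∈) initial

      percolates? : ∀ A → Dec (Percolates Adj 2 A)
      percolates? A with saturate A
      ... | L , A⊆L , L⊆I , cl =
        map′ (λ all v → L⊆I (All.lookup all (∈-vs v)))
             (λ perc → All.tabulate λ {v} _ → infected⇒closed cl A⊆L (perc v))
             (all? (_∈? L) vs)

      remove : V → List V → List V
      remove x = filter (λ y → ¬? (y ≟ x))

      minimise : ∀ fuel A → length A ≤ fuel → Unique A → Percolates Adj 2 A →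
        Σ (List V) λ B → (∀ {x} → x ∈ B → x ∈ A) × Unique B × MinimalPercolating Adj 2 B
      minimise fuel A len uniq perc with any? (λ x → percolates? (remove x A)) A
      ... | no none = A , (λ x∈ → x∈) , uniq , perc , λ B B⊆A (x , x∈A , x∉B) percB →
        none (lose x∈A λ v → infected⇒closed closed-infected
          (λ y∈B → initial (∈-filter⁺ (λ y → ¬? (y ≟ x)) (B⊆A y∈B) λ { refl → x∉B y∈B })) (percB v))
      minimise zero [] len uniq perc | yes ()
      minimise (suc fuel) A len uniq perc | yes some with find some
      ... | x , x∈A , perc′ with minimise fuel (remove x A)
              (≤-pred (≤-trans (filter-notAll (λ y → ¬? (y ≟ x)) A (lose x∈A (λ x≢x → x≢x refl))) len))
              (Unique.filter⁺ (λ y → ¬? (y ≟ x)) uniq) perc′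
      ... | B , B⊆ , uniqB , minB = B , (λ y∈ → proj₁ (∈-filter⁻ (λ y → ¬? (y ≟ x)) (B⊆ y∈))) , uniqB , minB

      minimal-subset : ∀ {A} → Unique A → Percolates Adj 2 A →
        Σ (List V) λ B → (∀ {x} → x ∈ B → x ∈ A) × Unique B × MinimalPercolating Adj 2 B
      minimal-subset {A} = minimise (length A) A ≤-refl

  -- Percolation in the grid

  vertices : ∀ n d → List (Vertex n d)
  vertices n zero = [] ∷ []
  vertices n (suc d) = cartesianProductWith _∷_ (allFin n) (vertices n d)

  ∈-vertices : (v : Vertex n d) → v ∈ vertices n d
  ∈-vertices [] = here refl
  ∈-vertices (i ∷ v) = ∈-cartesianProductWith⁺ _∷_ (∈-allFin i) (∈-vertices v)

  vertices-unique : ∀ n d → Unique (vertices n d)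
  vertices-unique n zero = [] ∷ []
  vertices-unique n (suc d) = UniqueSetoid.cartesianProductWith⁺ (setoid _) (setoid _) (setoid _) _∷_ ∷-injective
    (Unique.allFin⁺ n) (vertices-unique n d)

  GridAdj? : Decidable (GridAdj n d)
  GridAdj? u v = Fin.any? λ i →
    ((suc (toℕ (lookup u i)) ≟ toℕ (lookup v i)) ⊎-dec (suc (toℕ (lookup v i)) ≟ toℕ (lookup u i)))
    ×-dec Fin.all? λ j → ¬? (j Fin.≟ i) →-dec (lookup u j Fin.≟ lookup v j)

  minimal-subset-grid : {A : List (Vertex n d)} → Unique A → Percolates (GridAdj n d) 2 A →
    Σ (List (Vertex n d)) λ B → (∀ {x} → x ∈ B → x ∈ A) × Unique B × MinimalPercolating (GridAdj n d) 2 B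
  minimal-subset-grid = Finite.minimal-subset (≡-dec Fin._≟_) GridAdj? (vertices _ _) ∈-vertices

  emb : Vertex n d → Pt d
  emb = map toℕ

  emb-at : (v : Vertex n d) → ∀ k → emb v ! k ≡ toℕ (lookup v k)
  emb-at v k = lookup-map k toℕ v

  emb-injective : {u v : Vertex n d} → emb u ≡ emb v → u ≡ v
  emb-injective {u = []} {[]} _ = refl
  emb-injective {u = _ ∷ _} {_ ∷ _} eq =
    cong₂ _∷_ (Fin.toℕ-injective (proj₁ (∷-injective eq))) (emb-injective (proj₂ (∷-injective eq)))

  emb-surjective : (w : Pt d) → (∀ k → w ! k < n) → ∃ λ (v : Vertex n d) → emb v ≡ w
  emb-surjective {n = n} w w<n = tabulate (λ k → fromℕ< (w<n k)) , lookup-ext λ k →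
    trans (emb-at (tabulate (λ k → fromℕ< (w<n k))) k)
      (trans (cong toℕ (lookup∘tabulate (λ k → fromℕ< (w<n k)) k)) (Fin.toℕ-fromℕ< (w<n k)))

  GridAdj⇒Adj : {u v : Vertex n d} → GridAdj n d u v → Adj (emb u) (emb v)
  GridAdj⇒Adj {u = u} {v} (i , s , eq) = adj i (subst₂ Step (sym (emb-at u i)) (sym (emb-at v i)) s)
    λ j j≢i → trans (emb-at u j) (trans (cong toℕ (eq j j≢i)) (sym (emb-at v j)))

  Adj⇒GridAdj : {u v : Vertex n d} → Adj (emb u) (emb v) → GridAdj n d u v
  Adj⇒GridAdj {u = u} {v} (adj i s eq) = i , subst₂ Step (emb-at u i) (emb-at v i) s ,
    λ j j≢i → Fin.toℕ-injective (trans (sym (emb-at u j)) (trans (eq j j≢i) (emb-at v j)))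

  closed-pullback : {K : Pt d → Set} → Closed Adj K → Closed (GridAdj n d) (K ∘ emb)
  closed-pullback cl u≢w uv wv = cl (u≢w ∘ emb-injective) (GridAdj⇒Adj uv) (GridAdj⇒Adj wv)

  Box? : (l h v : Pt d) → Dec (Box l h v)
  Box? l h v = map′ mkBox at (Fin.all? λ k → (l ! k ≤? v ! k) ×-dec (v ! k ≤? h ! k))

  module Dense {d n c : ℕ} {lo hi : Pt (2 + d)} (crit : CriticalBox lo hi c)
    (lo≡0 : ∀ k → lo ! k ≡ 0) (hi<n : ∀ k → hi ! k < n) where

    open CriticalBox crit
    open DecMembership {A = Pt (2 + d)} (≡-dec _≟_) using (_∈?_)

    V = Vertex (suc n) (2 + d)

    f top : Pt (2 + d)
    f = bump zero (bump (suc zero) hi)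
    top = replicate (2 + d) n

    module F = Diagonal (bump-diagonal {i = zero} {j = suc zero} (λ ()) hi)

    top-at : ∀ k → top ! k ≡ n
    top-at k = lookup-replicate k n

    f≤top : ∀ k → f ! k ≤ top ! k
    f≤top k with k Fin.≟ zero | k Fin.≟ suc zero
    ... | yes refl | _ = ≤-trans (≤-reflexive F.at-i) (≤-trans (hi<n zero) (≤-reflexive (sym (top-at zero))))
    ... | _ | yes refl = ≤-trans (≤-reflexive F.at-j) (≤-trans (hi<n (suc zero)) (≤-reflexive (sym (top-at (suc zero)))))
    ... | no k≢i | no k≢j = ≤-trans (≤-reflexive (F.at-k k k≢i k≢j)) (≤-trans (<⇒≤ (hi<n k)) (≤-reflexive (sym (top-at k))))

    lo≤ : (w : Pt (2 + d)) → ∀ k → lo ! k ≤ w ! k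
    lo≤ w k rewrite lo≡0 k = z≤n

    hi≤top : ∀ k → hi ! k ≤ top ! k
    hi≤top k = ≤-trans (F.m≤p k) (f≤top k)

    emb∈ : (v : V) → Box lo top (emb v)
    emb∈ v .at k = lo≤ (emb v) k ,
      ≤-trans (≤-reflexive (emb-at v k)) (≤-trans (≤-pred (Fin.toℕ<n (lookup v k))) (≤-reflexive (sym (top-at k))))

    unemb : {w : Pt (2 + d)} → Box lo top w → ∃ λ (v : V) → emb v ≡ w
    unemb {w} b = emb-surjective w λ k → s≤s (≤-trans (proj₂ (at b k)) (≤-reflexive (top-at k)))

    A₀? : (v : V) → Dec (emb v ∈ A ⊎ Box f top (emb v))
    A₀? v = (emb v ∈? A) ⊎-dec Box? f top (emb v)

    A₀ : List V
    A₀ = filter A₀? (vertices (suc n) (2 + d))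

    Reached : Pt (2 + d) → Set
    Reached w = Σ V λ v → emb v ≡ w × Infected (GridAdj (suc n) (2 + d)) 2 A₀ v

    closed-reached : Closed Adj Reached
    closed-reached u≢w uv wv (u , refl , iu) (w , refl , iw)
      with unemb (closed-box u≢w uv wv (emb∈ u) (emb∈ w))
    ... | v , refl = v , refl , closed-infected (u≢w ∘ cong emb) (Adj⇒GridAdj uv) (Adj⇒GridAdj wv) iu iw

    reach₀ : {w : Pt (2 + d)} → Box lo top w → w ∈ A ⊎ Box f top w → Reached w
    reach₀ b w∈ with unemb b
    ... | v , refl = v , refl , initial (∈-filter⁺ A₀? (∈-vertices v) w∈)

    all-reached : Box lo top ⊆ Reached
    all-reached = F.corner-join closed-reached
      (spans closed-reached λ x∈ → reach₀ (enlarge (A⊆Box x∈)) (inj₁ x∈))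
      (λ {w} b → reach₀ (mkBox λ k → lo≤ w k , proj₂ (at b k)) (inj₂ b)) lo≤hi f≤top
      where
      enlarge : Box lo hi ⊆ Box lo top
      enlarge b = mkBox λ k → proj₁ (at b k) , ≤-trans (proj₂ (at b k)) (hi≤top k)

    percolates : Percolates (GridAdj (suc n) (2 + d)) 2 A₀
    percolates v = reached⇒infected (all-reached (emb∈ v))
      where
      reached⇒infected : Reached (emb v) → Infected (GridAdj (suc n) (2 + d)) 2 A₀ v
      reached⇒infected (_ , eq , iv) = subst (Infected _ 2 A₀) (emb-injective eq) iv

    -- Box f top is within distance 2 of the spanned box only at the corner hi, which the blocker avoids.
    necessary : {B : List V} → (∀ {x} → x ∈ B → x ∈ A₀) → Percolates (GridAdj (suc n) (2 + d)) 2 B →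
      ∀ {x} → x ∈ N → x ∈ List.map emb B
    necessary {B} B⊆A₀ perc {x} x∈N with x ∈? List.map emb B
    ... | yes x∈ = x∈
    ... | no x∉ = ⊥-elim (hi-uninfected (unemb (mkBox λ k → lo≤hi k , hi≤top k)))
      where
      open Blocker (blocker x∈N)
      hi∉F : ¬ Box f top hi
      hi∉F b = <⇒≱ (≤-reflexive (sym F.at-i)) (proj₁ (at b zero))
      closed′ : Closed Adj (K ∪ Box f top)
      closed′ = closed-∪ closed closed-box λ Ku bw uv wv →
        hi∉K (subst K (proj₁ (F.corner-contact (λ k → proj₂ (at (K⊆Box Ku) k)) (λ k → proj₁ (at bw k)) uv wv)) Ku)
      B⊆K : ∀ {b} → b ∈ B → (K ∪ Box f top) (emb b)
      B⊆K {b} b∈B with proj₂ (∈-filter⁻ A₀? {xs = vertices (suc n) (2 + d)} (B⊆A₀ b∈B))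
      ... | inj₁ b∈A = inj₁ (rest b∈A λ { refl → x∉ (∈-map⁺ emb b∈B) })
      ... | inj₂ b∈F = inj₂ b∈F
      hi-uninfected : ¬ ∃ λ (v : V) → emb v ≡ hi
      hi-uninfected (v , emb-v≡hi) = [ hi∉K , hi∉F ]′ (subst (K ∪ Box f top) emb-v≡hi
        (infected⇒closed (closed-pullback closed′) B⊆K (perc v)))

    dense : Σ (List V) λ B → Unique B × MinimalPercolating (GridAdj (suc n) (2 + d)) 2 B × c ≤ length B
    dense = count (minimal-subset-grid (Unique.filter⁺ A₀? (vertices-unique (suc n) (2 + d))) percolates)
      where
      count : (Σ (List V) λ B → (∀ {x} → x ∈ B → x ∈ A₀) × Unique B × MinimalPercolating (GridAdj (suc n) (2 + d)) 2 B) →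
        Σ (List V) λ B → Unique B × MinimalPercolating (GridAdj (suc n) (2 + d)) 2 B × c ≤ length B
      count (B , B⊆A₀ , uniq , minimal) = B , uniq , minimal , (begin
        c                        ≡⟨ N-length ⟨
        length N                 ≤⟨ unique-⊆⇒length≤ N-unique (necessary B⊆A₀ (proj₁ minimal)) ⟩
        length (List.map emb B)  ≡⟨ length-map emb B ⟩
        length B                 ∎)
        where open ≤-Reasoning

  dyadic-scale : ∀ {D n} → 1 ≤ D → D ≤′ n → ∃ λ m → D * 2 ^ m ≤ n × n < D * 2 ^ suc m
  dyadic-scale {D} 1≤D ≤′-refl = 0 , ≤-reflexive (*-identityʳ D) , (begin-strict
    D            <⟨ m<m+n D 1≤D ⟩
    D + D        ≡⟨ eq D ⟩
    D * (2 * 1)  ∎)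
    where
    open ≤-Reasoning
    eq : ∀ D → D + D ≡ D * (2 * 1)
    eq = solve-∀
  dyadic-scale {D} {suc n} 1≤D (≤′-step D≤′n) with dyadic-scale 1≤D D≤′n
  ... | m , lb , ub with <-≤-connex (suc n) (D * 2 ^ suc m)
  ...   | inj₁ lt = m , ≤-trans lb (n≤1+n n) , lt
  ...   | inj₂ ge = suc m , ge , (begin-strict
    suc n                         ≤⟨ ub ⟩
    D * 2 ^ suc m                 <⟨ m<m+n _ (*-mono-≤ 1≤D (m^n>0 2 (suc m))) ⟩
    D * 2 ^ suc m + D * 2 ^ suc m ≡⟨ eq D (2 ^ suc m) ⟩
    D * (2 * 2 ^ suc m)           ∎)
    where
    open ≤-Reasoning
    eq : ∀ a b → a * b + a * b ≡ a * (2 * b)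
    eq = solve-∀

  ^-distribʳ-* : ∀ m a b → (a * b) ^ m ≡ a ^ m * b ^ m
  ^-distribʳ-* zero a b = refl
  ^-distribʳ-* (suc m) a b =
    trans (cong (a * b *_) (^-distribʳ-* m a b)) ([m*n]*[o*p]≡[m*o]*[n*p] a b (a ^ m) (b ^ m))

  record LowerBound (E n d : ℕ) : Set where
    constructor lowerBound
    field
      A       : List (Vertex n d)
      uniq    : Unique A
      minimal : MinimalPercolating (GridAdj n d) 2 A
      size≥   : n ^ d ≤ E * length A

  some-minimal : ∀ n d → Σ (List (Vertex n d)) λ A → Unique A × MinimalPercolating (GridAdj n d) 2 A
  some-minimal n d = proj₁ r , proj₂ (proj₂ r)
    where r = minimal-subset-grid (vertices-unique n d) (λ v → initial (∈-vertices v))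

  percolating⇒nonempty : {A : List (Vertex n d)} → Vertex n d → Percolates (GridAdj n d) 2 A → 1 ≤ length A
  percolating⇒nonempty {A = []} v perc = ⊥-elim (infected⇒closed {K = λ _ → ⊥} (λ _ _ _ ()) (λ ()) (perc v))
  percolating⇒nonempty {A = _ ∷ _} _ _ = s≤s z≤n

  small-bound : ∀ E n d → n ^ d ≤ E → Vertex n d → LowerBound E n d
  small-bound E n d n^d≤E v with some-minimal n d
  ... | A , uniq , minimal = lowerBound A uniq minimal (≤-trans n^d≤E
    (≤-trans (≤-reflexive (sym (*-identityʳ E))) (*-monoʳ-≤ E (percolating⇒nonempty v (proj₁ minimal)))))

  -- On a path, no percolating set misses two consecutive vertices (nor an end vertex).
  path-bound : ∀ n → LowerBound 2 n 1
  path-bound n with some-minimal n 1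
  ... | A , uniq , minimal = lowerBound A uniq minimal (begin
    n ^ 1                              ≡⟨ *-identityʳ n ⟩
    n                                  ≡⟨ length-tabulate id ⟨
    length (allFin n)                  ≡⟨ length-map toℕ (allFin n) ⟨
    length (List.map toℕ (allFin n))   ≤⟨ unique-⊆⇒length≤ (Unique.map⁺ Fin.toℕ-injective (Unique.allFin⁺ n)) covered ⟩
    length (List.map pos A ++ List.map (suc ∘ pos) A) ≡⟨ length-++ (List.map pos A) ⟩
    length (List.map pos A) + length (List.map (suc ∘ pos) A) ≡⟨ cong₂ _+_ (length-map pos A) (length-map (suc ∘ pos) A) ⟩
    length A + length A                ≡⟨ eq (length A) ⟩
    2 * length A                       ∎)
    where
    open ≤-Reasoning
    open DecMembership _≟_ using (_∈?_)
    eq : ∀ a → a + a ≡ 2 * a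
    eq = solve-∀
    pos : Vertex n 1 → ℕ
    pos = toℕ ∘ head
    pos-injective : ∀ {u w} → pos u ≡ pos w → u ≡ w
    pos-injective {_ ∷ []} {_ ∷ []} e = cong (_∷ []) (Fin.toℕ-injective e)
    step-pos : ∀ {u v} → GridAdj n 1 u v → Step (pos u) (pos v)
    step-pos {_ ∷ []} {_ ∷ []} (zero , s , _) = s
    Avoids : ℕ → Vertex n 1 → Set
    Avoids x v = pos v ≢ x × suc (pos v) ≢ x
    closed-avoids : ∀ x → Closed (GridAdj n 1) (Avoids x)
    closed-avoids x {u} {w} {v} u≢w uv wv (u≢x , 1+u≢x) (w≢x , 1+w≢x) =
      at-x (step-pos {u} {v} uv) (step-pos {w} {v} wv) , below-x (step-pos {u} {v} uv) (step-pos {w} {v} wv)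
      where
      at-x : Step (pos u) (pos v) → Step (pos w) (pos v) → pos v ≢ x
      at-x (inj₁ e) _ refl = 1+u≢x e
      at-x _ (inj₁ e) refl = 1+w≢x e
      at-x (inj₂ e) (inj₂ e′) refl = u≢w (pos-injective (trans (sym e) e′))
      below-x : Step (pos u) (pos v) → Step (pos w) (pos v) → suc (pos v) ≢ x
      below-x (inj₂ e) _ refl = u≢x (sym e)
      below-x _ (inj₂ e) refl = w≢x (sym e)
      below-x (inj₁ e) (inj₁ e′) refl = u≢w (pos-injective (suc-injective (trans e (sym e′))))
    covered : ∀ {x} → x ∈ List.map toℕ (allFin n) → x ∈ List.map pos A ++ List.map (suc ∘ pos) A
    covered {x} x∈ with x ∈? (List.map pos A ++ List.map (suc ∘ pos) A)
    ... | yes x∈ys = x∈ys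
    ... | no x∉ys with ∈-map⁻ toℕ x∈
    ... | i , _ , refl = ⊥-elim (proj₁ (infected⇒closed (λ {u} {w} {v} → closed-avoids x {u} {w} {v}) A⊆ (proj₁ minimal (i ∷ []))) refl)
      where
      A⊆ : ∀ {v} → v ∈ A → Avoids x v
      A⊆ v∈ = (λ e → x∉ys (subst (_∈ _) e (∈-++⁺ˡ (∈-map⁺ pos v∈)))) ,
              (λ e → x∉ys (subst (_∈ _) e (∈-++⁺ʳ (List.map pos A) (∈-map⁺ (suc ∘ pos) v∈))))

  large-bound : ∀ d n m → scale (2 + d) * 2 ^ m ≤ suc n → suc n < scale (2 + d) * 2 ^ suc m →
    LowerBound ((2 * scale (2 + d)) ^ (2 + d)) (suc n) (2 + d)
  large-bound d n m lb ub =
    bound (Dense.dense (size-critical d m (replicate (2 + d) 0)) (λ k → lookup-replicate k 0) hi<n)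
    where
    open ≤-Reasoning
    D = scale (2 + d)
    hi<n : ∀ k → (replicate (2 + d) 0 ⊕ size d m) ! k < n
    hi<n k = ≤-pred (begin
      2 + (replicate (2 + d) 0 ⊕ size d m) ! k     ≡⟨ cong (2 +_) (⊕-at (replicate (2 + d) 0) (size d m) k) ⟩
      2 + (replicate (2 + d) 0 ! k + size d m ! k) ≡⟨ cong (λ t → 2 + (t + size d m ! k)) (lookup-replicate k 0) ⟩
      2 + size d m ! k                             ≤⟨ +-monoˡ-≤ (size d m ! k) {2} {D} (s≤s (s≤s z≤n)) ⟩
      D + size d m ! k                             ≤⟨ size-≤ d m k ⟩
      D * 2 ^ m                                    ≤⟨ lb ⟩
      suc n                                        ∎)
    eq : ∀ a b → a * (2 * b) ≡ 2 * a * b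
    eq = solve-∀
    swap : (2 ^ m) ^ (2 + d) ≡ (2 ^ (2 + d)) ^ m
    swap = trans (^-*-assoc 2 m (2 + d)) (trans (cong (2 ^_) (*-comm m (2 + d))) (sym (^-*-assoc 2 (2 + d) m)))
    bound : (Σ (List (Vertex (suc n) (2 + d))) λ A →
      Unique A × MinimalPercolating (GridAdj (suc n) (2 + d)) 2 A × (2 ^ (2 + d)) ^ m ≤ length A) →
      LowerBound ((2 * D) ^ (2 + d)) (suc n) (2 + d)
    bound (A , uniq , minimal , c≤) = lowerBound A uniq minimal (begin
      suc n ^ (2 + d)                        ≤⟨ ^-monoˡ-≤ (2 + d) (<⇒≤ ub) ⟩
      (D * (2 * 2 ^ m)) ^ (2 + d)            ≡⟨ cong (_^ (2 + d)) (eq D (2 ^ m)) ⟩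
      (2 * D * 2 ^ m) ^ (2 + d)              ≡⟨ ^-distribʳ-* (2 + d) (2 * D) (2 ^ m) ⟩
      (2 * D) ^ (2 + d) * (2 ^ m) ^ (2 + d)  ≡⟨ cong ((2 * D) ^ (2 + d) *_) swap ⟩
      (2 * D) ^ (2 + d) * (2 ^ (2 + d)) ^ m  ≤⟨ *-monoʳ-≤ ((2 * D) ^ (2 + d)) c≤ ⟩
      (2 * D) ^ (2 + d) * length A           ∎)

  constant : ℕ → ℕ
  constant d = (2 * scale d) ^ d

  lower-bound : ∀ n d → LowerBound (constant d) n d
  lower-bound n zero = small-bound 1 n 0 ≤-refl []
  lower-bound n (suc zero) = let lowerBound A uniq minimal n≤ = path-bound n in
    lowerBound A uniq minimal (≤-trans n≤ (*-monoˡ-≤ (length A) {2} {constant 1} (s≤s (s≤s z≤n))))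
  lower-bound zero (suc (suc d)) = let A , uniq , minimal = some-minimal 0 (2 + d) in
    lowerBound A uniq minimal z≤n
  lower-bound (suc n) (suc (suc d)) = [ small , large ]′ (<-≤-connex (suc n) D)
    where
    D = scale (2 + d)
    small : suc n < D → LowerBound (constant (2 + d)) (suc n) (2 + d)
    small n<D = small-bound (constant (2 + d)) (suc n) (2 + d)
      (^-monoˡ-≤ (2 + d) (≤-trans (<⇒≤ n<D) (m≤m+n D _))) (replicate (2 + d) zero)
    large : D ≤ suc n → LowerBound (constant (2 + d)) (suc n) (2 + d)
    large D≤n = let m , lb , ub = dyadic-scale {D} {suc n} (s≤s z≤n) (≤⇒≤′ D≤n) in large-bound d n m lb ub

  unit-fraction-bound : ∀ a b e → a ≤ suc e * b →
    (ℤ.+ 1 ℚ./ suc e) ℚ.* (ℤ.+ a ℚ./ 1) ℚ.≤ ℤ.+ b ℚ./ 1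
  unit-fraction-bound a b e a≤ = ℚ.toℚᵘ-cancel-≤ (begin
    ℚ.toℚᵘ ((ℤ.+ 1 ℚ./ suc e) ℚ.* (ℤ.+ a ℚ./ 1))          ≃⟨ ℚ.toℚᵘ-homo-* (ℤ.+ 1 ℚ./ suc e) (ℤ.+ a ℚ./ 1) ⟩
    ℚ.toℚᵘ (ℤ.+ 1 ℚ./ suc e) ℚᵘ.* ℚ.toℚᵘ (ℤ.+ a ℚ./ 1)
      ≃⟨ ℚᵘ.*-cong (ℚ.toℚᵘ-fromℚᵘ (ℚᵘ.mkℚᵘ (ℤ.+ 1) e)) (ℚ.toℚᵘ-fromℚᵘ (ℚᵘ.mkℚᵘ (ℤ.+ a) 0)) ⟩
    ℚᵘ.mkℚᵘ (ℤ.+ 1) e ℚᵘ.* ℚᵘ.mkℚᵘ (ℤ.+ a) 0              ≤⟨ ℚᵘ.*≤* bound ⟩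
    ℚᵘ.mkℚᵘ (ℤ.+ b) 0                                     ≃⟨ ℚ.toℚᵘ-fromℚᵘ (ℚᵘ.mkℚᵘ (ℤ.+ b) 0) ⟨
    ℚ.toℚᵘ (ℤ.+ b ℚ./ 1)                                   ∎)
    where
    open ℚᵘ.≤-Reasoning
    bound : (ℤ.+ 1 ℤ.* ℤ.+ a) ℤ.* ℤ.+ 1 ℤ.≤ ℤ.+ b ℤ.* ℤ.+ (suc e * 1)
    bound = subst₂ ℤ._≤_
      (sym (trans (ℤ.*-identityʳ (ℤ.+ 1 ℤ.* ℤ.+ a)) (ℤ.*-identityˡ (ℤ.+ a))))
      (ℤ.pos-* b (suc e * 1))
      (ℤ.+≤+ (≤-trans a≤ (≤-reflexive (trans (*-comm (suc e) b) (cong (b *_) (sym (*-identityʳ (suc e))))))))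

open Construction using (constant; lowerBound; lower-bound; unit-fraction-bound)
open import Data.Nat using (ℕ; suc; _^_)
open import Data.Nat.Properties using (≤-trans; m≤n+m)
open import Data.Integer using (+_)
open import Data.Rational using (ℚ; _/_; _*_; _≤_; _<_; 0ℚ)
open import Data.Rational.Properties using (positive⁻¹; normalize-pos)
open import Data.List using (List; length)
open import Data.List.Relation.Unary.Unique.Propositional using (Unique)
open import Data.Product using (Σ; _×_; _,_)

theorem6p2 : Σ (ℕ → ℚ) λ C →
    (∀ d → 0ℚ < C d) ×
    (∀ (n d : ℕ) → Σ (List (Vertex n d)) λ A →
    Unique A × MinimalPercolating (GridAdj n d) 2 A ×
    (C d * (+ (n ^ d) / 1) ≤ + (length A) / 1))
theorem6p2 = (λ d → + 1 / suc (constant d)) ,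
  (λ d → positive⁻¹ _ {{normalize-pos 1 (suc (constant d))}}) ,
  λ n d → let lowerBound A uniq minimal n^d≤ = lower-bound n d in
    A , uniq , minimal ,
    unit-fraction-bound (n ^ d) (length A) (constant d)
      (≤-trans n^d≤ (m≤n+m _ (length A)))
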